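{- For every integer $r\ge 2$ there is $C = C(r)>0$ such that the following holds. Let $G$ be an $n$-vertex graph and suppose either that $G$ is $3$-connected, or that $G$ is $2$-connected and $\iota(G)\ge C n^{ -1/2}$. Then $\mathcal{D}_r(G,\mathcal{T}_n)\ge \left\lfloor\frac{\iota(G)\cdot n}{C}\right\rfloor$.
   Context: Graphs are finite and simple; "$k$-connected" means $k$-vertex-connected. Spanning-tree discrepancy: for a connected $n$-vertex graph $G$, an $r$-colouring $f:E(G)\to[r]$ of its edges, and a spanning tree $T$ of $G$ (which has $n-1$ edges), put $D_f(T) := r\cdot\left(\max_{1\le i\le r}|f^{ -1}(i)\cap E(T)| - \frac{n-1}{r}\right)$. The $r$-colour spanning-tree discrepancy of $G$ is $\mathcal{D}_r(G,\mathcal{T}_n) := \min_{f:E(G)\to[r]}\ \max_{T} D_f(T)$, where the maximum is over all spanning trees $T$ of $G$. Vertex isoperimetric constant: $\iota(G)$ is the minimum of $|N(U)|/|U|$ over all $U\subseteq V(G)$ with $0<|U|\le |V(G)|/2$, where $N(U)$ is the external neighbourhood of $U$, i.e. the set of vertices outside $U$ that have a neighbour in $U$. -}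

module Defs where

open import Data.Empty using (⊥-elim)
open import Data.Fin using (Fin; zero; suc; finToFun)
import Data.Fin as Fin
open import Data.Fin.Properties using (any?; all?; injective⇒≤)
import Data.Fin.Properties as Fin
open import Data.Fin.Subset using (Subset; inside; outside; ∣_∣; _∩_; _∈_; _∉_)
open import Data.Fin.Subset.Properties using (_∈?_)
import Data.Integer as ℤ
open import Data.List
  using (List; []; _∷_; _∷ʳ_; _++_; map; filter; length; lookup; allFin; cartesianProduct)
import Data.List.Membership.Propositional as List
open import Data.List.Membership.Propositional.Properties using (∈-allFin; ∈-lookup)
open import Data.List.Relation.Unary.All as All using ()
open import Data.List.Relation.Unary.AllPairs using (allPairs?; []; _∷_)
open import Data.List.Relation.Unary.Any using (here; there)
open import Data.List.Relation.Unary.Linked using (Linked; linked?)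
open import Data.List.Relation.Unary.Unique.Propositional using (Unique)
open import Data.Nat as ℕ using (ℕ; zero; suc; _≤_; _<_; _≤?_; _<?_; z≤n; s≤s)
import Data.Nat.Properties as ℕ
open import Data.Product using (∃; ∃₂; _×_; _,_; proj₁; proj₂)
import Data.Product.Properties as Product
open import Data.Rational as ℚ using (ℚ; 0ℚ)
import Data.Rational.Properties as ℚ
open import Data.Sum using (_⊎_; inj₁; inj₂)
open import Data.Vec using ([]; _∷_; tabulate)
open import Function using (_∘_)
open import Level using (0ℓ)
open import Relation.Binary using (Rel; Decidable; Symmetric; Irreflexive; DecTotalOrder)
open import Relation.Binary.Construct.Closure.ReflexiveTransitive using (Star; ε; _◅_; _◅◅_)
open import Relation.Binary.PropositionalEquality using (_≡_; refl; sym; cong)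
open import Relation.Nullary using (¬_; Dec; yes; no; does; ¬?; _×-dec_; _⊎-dec_)
open import Relation.Nullary.Decidable using (map′)
import Relation.Unary as U
open import Data.List.Extrema (DecTotalOrder.totalOrder ℚ.≤-decTotalOrder) using (min; max)

private
  variable
    n r : ℕ

-- The value on the empty list is a convention; below it is only reached by
-- graphs for which the corresponding constant is undefined.
minimum : List ℚ → ℚ
minimum []       = 0ℚ
minimum (q ∷ qs) = min q qs

maximum : List ℚ → ℚ
maximum []       = 0ℚ
maximum (q ∷ qs) = max q qs

fromℕ : ℕ → ℚ
fromℕ m = ℤ.+ m ℚ./ 1

-- The clause for denominator 0 is never used in ι.
ratio : ℕ → ℕ → ℚ
ratio a zero      = 0ℚ
ratio a b@(suc _) = ℤ.+ a ℚ./ b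

subsets : ∀ n → List (Subset n)
subsets zero    = [] ∷ []
subsets (suc n) = map (outside ∷_) (subsets n) ++ map (inside ∷_) (subsets n)

-- `finToFun` is the bijection from Fin (k ^ m) to Fin m → Fin k.
functions : ∀ m k → List (Fin m → Fin k)
functions m k = map finToFun (allFin (k ℕ.^ m))

Connected : Rel (Fin n) 0ℓ → Set
Connected R = ∀ u v → Star R u v

-- The closed walk x, xs, x, where x ∷ xs are at least three distinct vertices.
IsCycle : Rel (Fin n) 0ℓ → Fin n → List (Fin n) → Set
IsCycle R x xs = 2 ≤ length xs × Unique (x ∷ xs) × Linked R (x ∷ (xs ∷ʳ x))

Acyclic : Rel (Fin n) 0ℓ → Set
Acyclic R = ¬ ∃₂ (IsCycle R)

module _ {R : Rel (Fin n) 0ℓ} (R? : Decidable R) where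

  -- Nonempty walks with all interior vertices in the given list (Warshall).
  Via : List (Fin n) → Rel (Fin n) 0ℓ
  Via []       u v = R u v
  Via (k ∷ ks) u v = Via ks u v ⊎ (Via ks u k × Via ks k v)

  via? : ∀ ks → Decidable (Via ks)
  via? []       u v = R? u v
  via? (k ∷ ks) u v = via? ks u v ⊎-dec (via? ks u k ×-dec via? ks k v)

  edge⇒via : ∀ ks {u v} → R u v → Via ks u v
  edge⇒via []       e = e
  edge⇒via (k ∷ ks) e = inj₁ (edge⇒via ks e)

  via⇒star : ∀ ks {u v} → Via ks u v → Star R u v
  via⇒star []       e              = e ◅ ε
  via⇒star (k ∷ ks) (inj₁ p)       = via⇒star ks p
  via⇒star (k ∷ ks) (inj₂ (p , q)) = via⇒star ks p ◅◅ via⇒star ks q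

  via-trans : ∀ ks {u w v} → w List.∈ ks → Via ks u w → Via ks w v → Via ks u v
  via-trans (k ∷ ks) (here refl) p q = inj₂ (to p , from q)
    where
    to : ∀ {u} → Via (k ∷ ks) u k → Via ks u k
    to (inj₁ p)       = p
    to (inj₂ (p , _)) = p
    from : ∀ {v} → Via (k ∷ ks) k v → Via ks k v
    from (inj₁ p)       = p
    from (inj₂ (_ , p)) = p
  via-trans (k ∷ ks) (there i) (inj₁ p)       (inj₁ q)       = inj₁ (via-trans ks i p q)
  via-trans (k ∷ ks) (there i) (inj₁ p)       (inj₂ (q , s)) = inj₂ (via-trans ks i p q , s)
  via-trans (k ∷ ks) (there i) (inj₂ (p , q)) (inj₁ s)       = inj₂ (p , via-trans ks i q s)
  via-trans (k ∷ ks) (there i) (inj₂ (p , _)) (inj₂ (_ , s)) = inj₂ (p , s)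

  star⇒via : ∀ {u v} → Star R u v → u ≡ v ⊎ Via (allFin n) u v
  star⇒via ε       = inj₁ refl
  star⇒via (e ◅ p) with star⇒via p
  ... | inj₁ refl = inj₂ (edge⇒via (allFin n) e)
  ... | inj₂ q    = inj₂ (via-trans (allFin n) (∈-allFin _) (edge⇒via (allFin n) e) q)

  star? : Decidable (Star R)
  star? u v = map′ (λ { (inj₁ refl) → ε ; (inj₂ p) → via⇒star (allFin n) p }) star⇒via
                   ((u Fin.≟ v) ⊎-dec via? (allFin n) u v)

  connected? : Dec (Connected R)
  connected? = all? λ u → all? λ v → star? u v

unique-lookup-injective : {xs : List (Fin n)} → Unique xs →
                          ∀ i j → lookup xs i ≡ lookup xs j → i ≡ j
unique-lookup-injective (_  ∷ _) zero    zero    _  = refl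
unique-lookup-injective (x∉ ∷ _) zero    (suc j) eq = ⊥-elim (All.lookup x∉ (∈-lookup j) eq)
unique-lookup-injective (x∉ ∷ _) (suc i) zero    eq = ⊥-elim (All.lookup x∉ (∈-lookup i) (sym eq))
unique-lookup-injective (_  ∷ u) (suc i) (suc j) eq = cong suc (unique-lookup-injective u i j eq)

unique⇒length≤ : {xs : List (Fin n)} → Unique xs → length xs ≤ n
unique⇒length≤ u = injective⇒≤ (unique-lookup-injective u _ _)

anyList? : ∀ k {P : List (Fin n) → Set} → U.Decidable P → Dec (∃ λ xs → length xs ≤ k × P xs)
anyList? zero P? = map′ (λ p → [] , z≤n , p) (λ { ([] , _ , p) → p }) (P? [])
anyList? (suc k) P? =
  map′ (λ { (inj₁ p) → [] , z≤n , p ; (inj₂ (x , xs , l , p)) → x ∷ xs , s≤s l , p })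
       (λ { ([] , _ , p) → inj₁ p ; (x ∷ xs , s≤s l , p) → inj₂ (x , xs , l , p) })
       (P? [] ⊎-dec any? λ x → anyList? k (P? ∘ (x ∷_)))

module _ {R : Rel (Fin n) 0ℓ} (R? : Decidable R) where

  isCycle? : ∀ x xs → Dec (IsCycle R x xs)
  isCycle? x xs = (2 ≤? length xs) ×-dec
                  (allPairs? (λ u v → ¬? (u Fin.≟ v)) (x ∷ xs) ×-dec
                   linked? R? (x ∷ (xs ∷ʳ x)))

  acyclic? : Dec (Acyclic R)
  acyclic? = ¬? (map′ (λ { (x , xs , _ , c) → x , xs , c })
                      (λ { (x , xs , c@(_ , u , _)) →
                             x , xs , ℕ.≤-trans (ℕ.n≤1+n _) (unique⇒length≤ u) , c })
                      (any? λ x → anyList? n (isCycle? x)))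

record Graph (n : ℕ) : Set₁ where
  field
    _~_      : Rel (Fin n) 0ℓ
    _~?_     : Decidable _~_
    ~-sym    : Symmetric _~_
    ~-irrefl : Irreflexive _≡_ _~_

module _ (G : Graph n) where
  open Graph G

  infix 4 _~[-_]_

  -- Adjacency in G − S.
  _~[-_]_ : Fin n → Subset n → Fin n → Set
  u ~[- S ] v = u ∉ S × v ∉ S × u ~ v

  -- More than k vertices, and no deletion of fewer than k vertices disconnects G.
  IsVertexConnected : ℕ → Set
  IsVertexConnected k = k < n × (∀ S → ∣ S ∣ < k → ∀ u v → u ∉ S → v ∉ S → Star (_~[- S ]_) u v)

  N : Subset n → Subset n
  N U = tabulate λ v → does (¬? (v ∈? U) ×-dec any? λ u → (u ∈? U) ×-dec (u ~? v))

  expansion : Subset n → ℚ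
  expansion U = ratio ∣ N U ∣ ∣ U ∣

  -- Meaningful for n ≥ 2, when an admissible U exists.
  ι : ℚ
  ι = minimum (map expansion (filter (λ U → (0 <? ∣ U ∣) ×-dec (2 ℕ.* ∣ U ∣ ≤? n)) (subsets n)))

  isEdge? : (p : Fin n × Fin n) → Dec (proj₁ p Fin.< proj₂ p × proj₁ p ~ proj₂ p)
  isEdge? (u , v) = (u Fin.<? v) ×-dec (u ~? v)

  -- Each edge is listed once, with its smaller endpoint first. Edges are
  -- referred to by their position in this list.
  edges : List (Fin n × Fin n)
  edges = filter isEdge? (cartesianProduct (allFin n) (allFin n))

  Edge : Set
  Edge = Fin (length edges)

  EdgeSet : Set
  EdgeSet = Subset (length edges)

  Joins : Edge → Rel (Fin n) 0ℓ
  Joins e u v = lookup edges e ≡ (u , v) ⊎ lookup edges e ≡ (v , u)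

  -- Adjacency in the spanning subgraph (V(G), T).
  Adj : EdgeSet → Rel (Fin n) 0ℓ
  Adj T u v = ∃ λ e → e ∈ T × Joins e u v

  adj? : ∀ T → Decidable (Adj T)
  adj? T u v = any? λ e → (e ∈? T) ×-dec ((lookup edges e ≟ (u , v)) ⊎-dec (lookup edges e ≟ (v , u)))
    where _≟_ = Product.≡-dec Fin._≟_ Fin._≟_

  IsSpanningTree : EdgeSet → Set
  IsSpanningTree T = Connected (Adj T) × Acyclic (Adj T)

  isSpanningTree? : U.Decidable IsSpanningTree
  isSpanningTree? T = connected? (adj? T) ×-dec acyclic? (adj? T)

  spanningTrees : List EdgeSet
  spanningTrees = filter isSpanningTree? (subsets (length edges))

  colourClass : (Edge → Fin r) → Fin r → EdgeSet
  colourClass f i = tabulate λ e → does (f e Fin.≟ i)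

  module _ (r : ℕ) .{{_ : ℕ.NonZero r}} where

    treeDiscrepancy : (Edge → Fin r) → EdgeSet → ℚ
    treeDiscrepancy f T =
      fromℕ r ℚ.* (maximum (map (λ i → fromℕ ∣ colourClass f i ∩ T ∣) (allFin r))
                   ℚ.- ((ℤ.+ n ℤ.- ℤ.1ℤ) ℚ./ r))

    -- Meaningful for connected G, when a spanning tree exists.
    discrepancy : ℚ
    discrepancy = minimum (map (λ f → maximum (map (treeDiscrepancy f) spanningTrees))
                               (functions (length edges) r))

{-# OPTIONS --safe #-}
-- Suppose no spanning tree is unbalanced by d. Then the colours have ranks ρ i with
-- r · ρ i ≤ n + d − 2, so the colour components ("blocks") satisfy Σ (|K| − 1) ≤ n + d − 2: the
-- hypergraph of blocks is a tree up to d − 1 extra incidences. If A is a connected union of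
-- blocks with at least two vertices, then by 2-connectivity every component of the remaining
-- blocks meets A in at least two vertices, and counting ranks inside and outside A shows that the
-- boundary of A (the vertices of A lying in a block that leaves A) has at most 2d vertices. Now
-- grow A from a single vertex, one block at a time. The boundary separates the interior of A from
-- the complement of A, so expansion forces one of the two to be tiny at each stage. The step at
-- which the tiny side changes would add a block with almost all vertices, whereas each block has
-- at most (n + d) / 2 of them. The estimates close with C = 64 for every r.
module Submission where

open import Defs
open import Data.Nat using (ℕ; NonZero; _≤_)
open import Data.Product using (Σ-syntax; _×_)
open import Data.Rational as ℚ using (ℚ; 0ℚ; floor; _÷_; >-nonZero)
open import Data.Sum using (_⊎_)
open import Data.Empty using (⊥; ⊥-elim)
open import Data.Fin as Fin using (Fin; suc; zero)
open import Data.Fin.Induction using (<-wellFounded; >-wellFounded)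
open import Data.Fin.Properties using (all?; any?)
import Data.Fin.Properties as Fin
open import Data.Fin.Subset
  using (Subset; _-_; _∈_; _∉_; _∩_; _∪_; _⊆_; inside; outside; ⁅_⁆; ∁; ∣_∣; ⊤)
import Data.Fin.Subset as Subset
open import Data.Fin.Subset.Properties
  using (_∈?_; drop-there; p∪∁p≡⊤; p⊂q⇒∣p∣<∣q∣; p⊆p∪q; p⊆q⇒∣p∣≤∣q∣; q⊆p∪q; x∈p⇒∣p-x∣<∣p∣;
    x∈p∧x≢y⇒x∈p-y; x∈p∩q⁺; x∈p∪q⁺; x∈p∪q⁻; x∈⁅x⁆; x∈⁅y⁆⇒x≡y; x∈∁p⇒x∉p; x∉∁p⇒x∈p; ∈⊤; ∉⊥; ∣p∣≤n;
    ∣⁅x⁆∣≡1; ∣∁p∣≡n∸∣p∣; ∣⊤∣≡n; ∣⊥∣≡0)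
import Data.Integer as ℤ
import Data.Integer.DivMod as ℤ
import Data.Integer.Properties as ℤ
open import Data.List as List
  using (List; []; _++_; _∷_; _∷ʳ_; allFin; concatMap; filter; length; lookup; map)
open import Data.List.Membership.Propositional as List using ()
open import Data.List.Membership.Propositional.Properties
  using (∈-++⁺ʳ; ∈-++⁺ˡ; ∈-allFin; ∈-cartesianProduct⁺; ∈-concatMap⁺; ∈-filter⁺; ∈-map⁺; ∈-map⁻)
import Data.List.Properties as List
open import Data.List.Relation.Unary.All as All using (All; []; _∷_)
import Data.List.Relation.Unary.All.Properties as All
open import Data.List.Relation.Unary.AllPairs using (_∷_)
open import Data.List.Relation.Unary.Any as Any using (Any; here; there)
open import Data.List.Relation.Unary.Any.Properties using (lookup-index)
open import Data.List.Relation.Unary.Linked using (Linked; [-]; _∷_)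
open import Data.Nat as ℕ using (_*_; _+_; _<?_; _<_; _≤?_; suc; s≤s; zero; z≤n; ⌈_/2⌉; ⌊_/2⌋)
import Data.Nat.Properties as ℕ
open import Data.Nat.Tactic.RingSolver using (solve-∀)
open import Data.Product using (_,_; proj₁; proj₂; ∃; ∃₂)
import Data.Product.Properties as Product
import Data.Rational.Properties as ℚ
import Data.Rational.Unnormalised as ℚᵘ
import Data.Rational.Unnormalised.Properties as ℚᵘ
open import Data.Sum using ([_,_]′; inj₁; inj₂)
open import Data.Vec using ([]; _∷_; here; tabulate; there)
open import Data.Vec.Properties using ([]=⇒lookup; lookup⇒[]=; lookup∘tabulate)
open import Function using (_∘_; id)
open import Induction.WellFounded using (Acc; WellFounded; acc)
open import Level using (0ℓ)
open import Relation.Binary using (DecTotalOrder; Decidable; Rel; tri<; tri≈; tri>)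
open import Relation.Binary.Construct.Closure.ReflexiveTransitive as Star using (Star; _◅_; _◅◅_; ε)
open import Relation.Binary.PropositionalEquality
open import Relation.Nullary using (Dec; _×-dec_; _→-dec_; _⊎-dec_; does; no; yes; ¬?; ¬_)
open import Relation.Nullary.Decidable using (dec-true)
import Relation.Unary as U
open import Data.List.Extrema (DecTotalOrder.totalOrder ℚ.≤-decTotalOrder)
  using (min≤xs; min≤⊤; v≤min⁺; xs≤max; ⊥≤max)

private
  variable
    n r : ℕ

-- Subsets of a finite set and their cardinalities.

module _ {P : Fin n → Set} (P? : U.Decidable P) where

  ⟦_⟧ : Subset n
  ⟦_⟧ = tabulate (does ∘ P?)

  ∈⟦⟧⁺ : ∀ {x} → P x → x ∈ ⟦_⟧
  ∈⟦⟧⁺ {x} p = lookup⇒[]= x _ (trans (lookup∘tabulate _ x) (dec-true (P? x) p))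

  ∈⟦⟧⁻ : ∀ {x} → x ∈ ⟦_⟧ → P x
  ∈⟦⟧⁻ {x} x∈ with P? x | trans (sym (lookup∘tabulate (does ∘ P?) x)) ([]=⇒lookup x∈)
  ... | yes p | _ = p
  ... | no  _ | ()

unfixed? : (κ : Fin n → Fin n) → ∀ v → Dec (κ v ≢ v)
unfixed? κ v = ¬? (κ v Fin.≟ v)

-- For an idempotent choice of representatives these are the non-representatives, so their number is
-- the rank of the partition: n minus the number of classes.
unfixed : (Fin n → Fin n) → Subset n
unfixed κ = ⟦ unfixed? κ ⟧

elements : Subset n → List (Fin n)
elements []            = []
elements (inside  ∷ p) = zero ∷ map suc (elements p)
elements (outside ∷ p) = map suc (elements p)

length-elements : (p : Subset n) → length (elements p) ≡ ∣ p ∣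
length-elements []            = refl
length-elements (inside  ∷ p) = cong suc (trans (List.length-map suc (elements p)) (length-elements p))
length-elements (outside ∷ p) = trans (List.length-map suc (elements p)) (length-elements p)

∈-elements : {p : Subset n} {x : Fin n} → x ∈ p → x List.∈ elements p
∈-elements {p = inside  ∷ p} here      = here refl
∈-elements {p = inside  ∷ p} (there i) = there (∈-map⁺ suc (∈-elements i))
∈-elements {p = outside ∷ p} (there i) = ∈-map⁺ suc (∈-elements i)

elements-∈ : {p : Subset n} {x : Fin n} → x List.∈ elements p → x ∈ p
elements-∈ {p = inside  ∷ p} (here refl) = here
elements-∈ {p = inside  ∷ p} (there i)   with ∈-map⁻ suc i
... | _ , j , refl = there (elements-∈ j)
elements-∈ {p = outside ∷ p} i           with ∈-map⁻ suc i
... | _ , j , refl = there (elements-∈ j)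

∣p∪q∣≤∣p∣+∣q∣ : (p q : Subset n) → ∣ p ∪ q ∣ ≤ ∣ p ∣ + ∣ q ∣
∣p∪q∣≤∣p∣+∣q∣ []            []            = z≤n
∣p∪q∣≤∣p∣+∣q∣ (outside ∷ p) (outside ∷ q) = ∣p∪q∣≤∣p∣+∣q∣ p q
∣p∪q∣≤∣p∣+∣q∣ (outside ∷ p) (inside  ∷ q) =
  ℕ.≤-trans (s≤s (∣p∪q∣≤∣p∣+∣q∣ p q)) (ℕ.≤-reflexive (sym (ℕ.+-suc ∣ p ∣ ∣ q ∣)))
∣p∪q∣≤∣p∣+∣q∣ (inside  ∷ p) (outside ∷ q) = s≤s (∣p∪q∣≤∣p∣+∣q∣ p q)
∣p∪q∣≤∣p∣+∣q∣ (inside  ∷ p) (inside  ∷ q) =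
  s≤s (ℕ.≤-trans (∣p∪q∣≤∣p∣+∣q∣ p q) (ℕ.+-monoʳ-≤ ∣ p ∣ (ℕ.n≤1+n _)))

disjoint⇒∣p∣+∣q∣≤∣d∣ : (p q d : Subset n) → p ⊆ d → q ⊆ d → (∀ {x} → x ∈ p → x ∉ q) →
                       ∣ p ∣ + ∣ q ∣ ≤ ∣ d ∣
disjoint⇒∣p∣+∣q∣≤∣d∣ [] [] [] _ _ _ = z≤n
disjoint⇒∣p∣+∣q∣≤∣d∣ (x ∷ p) (y ∷ q) (z ∷ d) p⊆d q⊆d p∩q = step x y z p⊆d q⊆d p∩q
  where
  rec : ∣ p ∣ + ∣ q ∣ ≤ ∣ d ∣
  rec = disjoint⇒∣p∣+∣q∣≤∣d∣ p q d (drop-there ∘ p⊆d ∘ there) (drop-there ∘ q⊆d ∘ there)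
          (λ i j → p∩q (there i) (there j))
  step : ∀ x y z → x ∷ p ⊆ z ∷ d → y ∷ q ⊆ z ∷ d → (∀ {i} → i ∈ x ∷ p → i ∉ y ∷ q) →
         ∣ x ∷ p ∣ + ∣ y ∷ q ∣ ≤ ∣ z ∷ d ∣
  step inside  inside  _       s t u = ⊥-elim (u here here)
  step inside  outside outside s t u with () ← s here
  step outside inside  outside s t u with () ← t here
  step inside  outside inside  s t u = s≤s rec
  step outside inside  inside  s t u = ℕ.≤-trans (ℕ.≤-reflexive (ℕ.+-suc ∣ p ∣ ∣ q ∣)) (s≤s rec)
  step outside outside inside  s t u = ℕ.m≤n⇒m≤1+n rec
  step outside outside outside s t u = rec

∣p∪⁅x⁆∣≤1+∣p∣ : (p : Subset n) (x : Fin n) → ∣ p ∪ ⁅ x ⁆ ∣ ≤ suc ∣ p ∣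
∣p∪⁅x⁆∣≤1+∣p∣ p x = subst (∣ p ∪ ⁅ x ⁆ ∣ ≤_) (trans (cong (∣ p ∣ +_) (∣⁅x⁆∣≡1 x)) (ℕ.+-comm ∣ p ∣ 1))
                      (∣p∪q∣≤∣p∣+∣q∣ p ⁅ x ⁆)

-- Walks along a list of edges.

Link : List (Fin n × Fin n) → Rel (Fin n) 0ℓ
Link L u v = Any (λ e → e ≡ (u , v) ⊎ e ≡ (v , u)) L

link? : (L : List (Fin n × Fin n)) → Decidable (Link L)
link? L u v = Any.any? (λ e → (e ≟ (u , v)) ⊎-dec (e ≟ (v , u))) L
  where _≟_ = Product.≡-dec Fin._≟_ Fin._≟_

link-sym : (L : List (Fin n × Fin n)) → ∀ {u v} → Link L u v → Link L v u
link-sym L = Any.map λ { (inj₁ e) → inj₂ e ; (inj₂ e) → inj₁ e }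

-- A walk through the edge is cut before its first use and after its last; all four combinations of
-- endpoints can occur.
split-walk : ∀ {L : List (Fin n × Fin n)} {x y u v} → Star (Link ((x , y) ∷ L)) u v →
             Star (Link L) u v ⊎
             ((Star (Link L) u x ⊎ Star (Link L) u y) × (Star (Link L) x v ⊎ Star (Link L) y v))
split-walk ε = inj₁ ε
split-walk (here (inj₁ refl) ◅ s) with split-walk s
... | inj₁ t       = inj₂ (inj₁ ε , inj₂ t)
... | inj₂ (_ , t) = inj₂ (inj₁ ε , t)
split-walk (here (inj₂ refl) ◅ s) with split-walk s
... | inj₁ t       = inj₂ (inj₂ ε , inj₁ t)
... | inj₂ (_ , t) = inj₂ (inj₂ ε , t)
split-walk (there l ◅ s) with split-walk s
... | inj₁ t            = inj₁ (l ◅ t)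
... | inj₂ (inj₁ p , t) = inj₂ (inj₁ (l ◅ p) , t)
... | inj₂ (inj₂ p , t) = inj₂ (inj₂ (l ◅ p) , t)

-- Deleting an edge costs at most one new root: `y` if `x` still reaches `P`, and `x` otherwise.
-- Once no edge is left, `A` lies inside `P`.
reach-bound : (L : List (Fin n × Fin n)) (A P : Subset n) →
              (∀ {a} → a ∈ A → ∃ λ p → p ∈ P × Star (Link L) a p) →
              ∣ A ∣ ≤ ∣ P ∣ + length L
reach-bound [] A P reach = subst (∣ A ∣ ≤_) (sym (ℕ.+-identityʳ ∣ P ∣)) (p⊆q⇒∣p∣≤∣q∣ A⊆P)
  where
  A⊆P : A ⊆ P
  A⊆P a∈A with reach a∈A
  ... | p , p∈P , ε       = p∈P
  ... | p , p∈P , (() ◅ _)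
reach-bound ((x , y) ∷ L) A P reach
  with any? (λ p → (p ∈? P) ×-dec star? (link? L) x p)
... | yes (p , p∈P , xp) = ℕ.≤-trans (reach-bound L A (P ∪ ⁅ y ⁆) reach′)
  (ℕ.≤-trans (ℕ.+-monoˡ-≤ (length L) (∣p∪⁅x⁆∣≤1+∣p∣ P y))
             (ℕ.≤-reflexive (sym (ℕ.+-suc ∣ P ∣ (length L)))))
  where
  reach′ : ∀ {a} → a ∈ A → ∃ λ q → q ∈ P ∪ ⁅ y ⁆ × Star (Link L) a q
  reach′ a∈A with reach a∈A
  ... | q , q∈P , s with split-walk s
  ... | inj₁ t            = q , x∈p∪q⁺ (inj₁ q∈P) , t
  ... | inj₂ (inj₁ t , _) = p , x∈p∪q⁺ (inj₁ p∈P) , (t ◅◅ xp)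
  ... | inj₂ (inj₂ t , _) = y , x∈p∪q⁺ (inj₂ (x∈⁅x⁆ y)) , t
... | no ¬xP = ℕ.≤-trans (reach-bound L A (P ∪ ⁅ x ⁆) reach′)
  (ℕ.≤-trans (ℕ.+-monoˡ-≤ (length L) (∣p∪⁅x⁆∣≤1+∣p∣ P x))
             (ℕ.≤-reflexive (sym (ℕ.+-suc ∣ P ∣ (length L)))))
  where
  reach′ : ∀ {a} → a ∈ A → ∃ λ q → q ∈ P ∪ ⁅ x ⁆ × Star (Link L) a q
  reach′ a∈A with reach a∈A
  ... | q , q∈P , s with split-walk s
  ... | inj₁ t                 = q , x∈p∪q⁺ (inj₁ q∈P) , t
  ... | inj₂ (inj₁ t , _)      = x , x∈p∪q⁺ (inj₂ (x∈⁅x⁆ x)) , t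
  -- Here `x` cannot reach `P`, so the walk last leaves the edge at `y`, and `y` reaches `P`
  -- already.
  ... | inj₂ (inj₂ _ , inj₁ t) = ⊥-elim (¬xP (q , q∈P , t))
  ... | inj₂ (inj₂ t , inj₂ u) = q , x∈p∪q⁺ (inj₁ q∈P) , (t ◅◅ u)

-- Walks in a 2-connected graph.

module _ (G : Graph n) (conn : IsVertexConnected G 2) where
  open Graph G

  connected : ∀ u v → Star _~_ u v
  connected u v = Star.map (proj₂ ∘ proj₂)
    (proj₂ conn Subset.⊥ (subst (_< 2) (sym (∣⊥∣≡0 n)) (s≤s z≤n)) u v ∉⊥ ∉⊥)

  connected-without : ∀ p u v → u ≢ p → v ≢ p → Star (λ a b → _~[-_]_ G a ⁅ p ⁆ b) u v
  connected-without p u v u≢p v≢p =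
    proj₂ conn ⁅ p ⁆ (subst (_< 2) (sym (∣⁅x⁆∣≡1 p)) (s≤s (s≤s z≤n))) u v
      (u≢p ∘ x∈⁅y⁆⇒x≡y p) (v≢p ∘ x∈⁅y⁆⇒x≡y p)

-- For symmetric `R` and a strict total order `≺`, `extremal` holds one vertex of `D` from each
-- component of `R` that meets `D`. The order is a parameter so that one construction gives both
-- least and greatest representatives.
module Extremal {R : Rel (Fin n) 0ℓ} (R? : Decidable R) (D : Subset n)
                {_≺_ : Rel (Fin n) 0ℓ} (_≺?_ : Decidable _≺_) where

  below? : ∀ p → Dec (∃ λ q → q ∈ D × Star R p q × q ≺ p)
  below? p = any? λ q → (q ∈? D) ×-dec (star? R? p q ×-dec (q ≺? p))

  extremal? : ∀ p → Dec (p ∈ D × ¬ ∃ λ q → q ∈ D × Star R p q × q ≺ p)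
  extremal? p = (p ∈? D) ×-dec ¬? (below? p)

  extremal : Subset n
  extremal = ⟦ extremal? ⟧

  extremal⊆ : extremal ⊆ D
  extremal⊆ p∈ = proj₁ (∈⟦⟧⁻ extremal? p∈)

  extremal-least : ∀ {p q} → p ∈ extremal → q ∈ D → Star R p q → ¬ q ≺ p
  extremal-least p∈ q∈D pq q≺p = proj₂ (∈⟦⟧⁻ extremal? p∈) (_ , q∈D , pq , q≺p)

  reach-extremal : WellFounded _≺_ → ∀ {p} → p ∈ D → ∃ λ q → q ∈ extremal × Star R p q
  reach-extremal wf p∈D = go p∈D (wf _)
    where
    go : ∀ {p} → p ∈ D → Acc _≺_ p → ∃ λ q → q ∈ extremal × Star R p q
    go {p} p∈D (acc rs) with below? p
    ... | no minimal                = p , ∈⟦⟧⁺ extremal? (p∈D , minimal) , ε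
    ... | yes (q , q∈D , pq , q≺p) with go q∈D (rs q≺p)
    ...   | e , e∈ , qe = e , e∈ , (pq ◅◅ qe)

length-filter-¬ : {A : Set} {P : A → Set} (P? : U.Decidable P) (xs : List A) →
                  length (filter P? xs) + length (filter (¬? ∘ P?) xs) ≡ length xs
length-filter-¬ P? []       = refl
length-filter-¬ P? (x ∷ xs) with P? x
... | yes _ = cong suc (length-filter-¬ P? xs)
... | no  _ = trans (ℕ.+-suc (length (filter P? xs)) _) (cong suc (length-filter-¬ P? xs))

-- In the application c, e and b are the sizes of `A`, its complement and its boundary, i and o
-- count inner and outer spokes, and s and t are the sizes of two sets of representatives. The first
-- two inequalities are added twice, the next three once.
double-count : ∀ {n c e b i o s t k} → n ≤ c + e → c ≤ 1 + i → e + b ≤ s + o → e + b ≤ t + o →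
        s + t ≤ b → i + o ≡ k → b + 2 * n ≤ 2 + 2 * k
double-count {n} {c} {e} {b} {i} {o} {s} {t} h₁ h₂ h₃ h₄ h₅ refl =
  ℕ.+-cancelˡ-≤ (2 * c + 2 * e + s + t + b) _ _
    (subst₂ _≤_ (lhs n c e b s t) (rhs c e b i o s t)
      (ℕ.+-mono-≤ (ℕ.*-monoʳ-≤ 2 (ℕ.+-mono-≤ h₁ h₂))
        (ℕ.+-mono-≤ (ℕ.+-mono-≤ h₃ h₄) h₅)))
  where
  lhs : ∀ n c e b s t → 2 * (n + c) + (((e + b) + (e + b)) + (s + t)) ≡
                        2 * c + 2 * e + s + t + b + (b + 2 * n)
  lhs = solve-∀
  rhs : ∀ c e b i o s t → 2 * ((c + e) + (1 + i)) + (((s + o) + (t + o)) + b) ≡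
                          2 * c + 2 * e + s + t + b + (2 + 2 * (i + o))
  rhs = solve-∀

-- Blocks, their spokes and their boundaries.

-- Each κ i encodes a partition of the vertices, its blocks being the fibres of κ i. In the
-- application κ i v represents the component of v in colour i, so ρ i is the rank of that colour.
module Blocks (κ : Fin r → Fin n → Fin n) where

  ρ : Fin r → ℕ
  ρ i = ∣ unfixed (κ i) ∣

  -- Joining every v to κ i v turns each block into a star.
  spokes : List (Fin r × Fin n)
  spokes = concatMap (λ i → map (i ,_) (elements (unfixed (κ i)))) (allFin r)

  ∈-spokes : ∀ {i v} → κ i v ≢ v → (i , v) List.∈ spokes
  ∈-spokes {i} {v} ≢v = ∈-concatMap⁺ (λ i → map (i ,_) (elements (unfixed (κ i))))
    (Any.map (λ { refl → ∈-map⁺ (i ,_) (∈-elements (∈⟦⟧⁺ (unfixed? (κ i)) ≢v)) })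
             (∈-allFin i))

  -- Each of the r colours contributes at most M to r times the number of spokes. The factor r stays
  -- on both sides because it need not divide M.
  spokes-bound : ∀ {M} → (∀ i → r * ρ i ≤ M) → r * length spokes ≤ r * M
  spokes-bound {M} bound = subst (λ l → r * length spokes ≤ l * M) (List.length-tabulate {n = r} id)
                             (go (allFin r))
    where
    go : ∀ is → r * length (concatMap (λ i → map (i ,_) (elements (unfixed (κ i)))) is) ≤ length is * M
    go []       = ℕ.≤-reflexive (ℕ.*-zeroʳ r)
    go (i ∷ is) = begin
      r * length (map (i ,_) (elements (unfixed (κ i))) ++ rest)
        ≡⟨ cong (r *_) (List.length-++ (map (i ,_) (elements (unfixed (κ i))))) ⟩
      r * (length (map (i ,_) (elements (unfixed (κ i)))) + length rest)
        ≡⟨ cong (λ x → r * (x + length rest))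
             (trans (List.length-map (i ,_) (elements (unfixed (κ i)))) (length-elements (unfixed (κ i)))) ⟩
      r * (ρ i + length rest)       ≡⟨ ℕ.*-distribˡ-+ r (ρ i) (length rest) ⟩
      r * ρ i + r * length rest     ≤⟨ ℕ.+-mono-≤ (bound i) (go is) ⟩
      M + length is * M             ∎
      where
      open ℕ.≤-Reasoning
      rest = concatMap (λ i → map (i ,_) (elements (unfixed (κ i)))) is

  -- A block is named by its colour and the common value of `κ` on it. `B` will select the blocks
  -- inside a set or those leaving it, so that the two selections split the spokes.
  module Steps {B : Fin r → Fin n → Set} (B? : ∀ i v → Dec (B i v)) where

    Step : Rel (Fin n) 0ℓ
    Step u v = ∃ λ i → κ i u ≡ κ i v × B i (κ i u)

    step? : Decidable Step
    step? u v = any? λ i → (κ i u Fin.≟ κ i v) ×-dec B? i (κ i u)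

    step-sym : ∀ {u v} → Step u v → Step v u
    step-sym (i , eq , b) = i , sym eq , subst (B i) eq b

    chosen? : (s : Fin r × Fin n) → Dec (B (proj₁ s) (κ (proj₁ s) (proj₂ s)))
    chosen? (i , v) = B? i (κ i v)

    chosen : List (Fin r × Fin n)
    chosen = filter chosen? spokes

    links : List (Fin n × Fin n)
    links = map (λ (i , v) → v , κ i v) chosen

    to-rep : ∀ {i u} → B i (κ i u) → Star (Link links) u (κ i u)
    to-rep {i} {u} b with κ i u Fin.≟ u
    ... | yes eq = subst (Star (Link links) u) (sym eq) ε
    ... | no  ≢u = Any.map (λ eq → inj₁ (sym eq))
                     (∈-map⁺ (λ (i , v) → v , κ i v) (∈-filter⁺ chosen? (∈-spokes ≢u) b)) ◅ ε

    step⇒walk : ∀ {u v} → Step u v → Star (Link links) u v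
    step⇒walk {u} {v} (i , eq , b) = to-rep b ◅◅
      subst (λ c → Star (Link links) c v) (sym eq)
        (Star.reverse (link-sym links) (to-rep (subst (B i) eq b)))

    step-bound : (A P : Subset n) → (∀ {a} → a ∈ A → ∃ λ p → p ∈ P × Star Step a p) →
                 ∣ A ∣ ≤ ∣ P ∣ + length chosen
    step-bound A P reach = subst (λ l → ∣ A ∣ ≤ ∣ P ∣ + l) (List.length-map _ chosen)
      (reach-bound links A P λ a∈A →
        let p , p∈P , s = reach a∈A in p , p∈P , Star.kleisliStar id step⇒walk s)

  Within : Subset n → Fin r → Fin n → Set
  Within A i c = ∀ w → κ i w ≡ c → w ∈ A

  within? : ∀ A i c → Dec (Within A i c)
  within? A i c = all? λ w → (κ i w Fin.≟ c) →-dec (w ∈? A)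

  ∂? : ∀ A v → Dec (v ∈ A × ∃ λ i → ¬ Within A i (κ i v))
  ∂? A v = (v ∈? A) ×-dec any? λ i → ¬? (within? A i (κ i v))

  ∂ : Subset n → Subset n
  ∂ A = ⟦ ∂? A ⟧

  module In  (A : Subset n) = Steps {B = Within A} (within? A)
  module Out (A : Subset n) = Steps {B = λ i c → ¬ Within A i c} (λ i c → ¬? (within? A i c))

  escape : ∀ {A i c} → ¬ Within A i c → ∃ λ w → κ i w ≡ c × w ∉ A
  escape {A} {i} {c} ¬within
    with Fin.¬∀⟶∃¬ n _ (λ w → (κ i w Fin.≟ c) →-dec (w ∈? A)) ¬within
  ... | w , ¬imp with κ i w Fin.≟ c | w ∈? A
  ...   | _      | yes w∈A = ⊥-elim (¬imp λ _ → w∈A)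
  ...   | yes eq | no  w∉A = w , eq , w∉A
  ...   | no ≢c  | no  _   = ⊥-elim (¬imp λ eq → ⊥-elim (≢c eq))

  -- Connectedness of `A` through the blocks inside it, in the form that bounds `∣ A ∣` by one plus
  -- the number of inner spokes.
  Rooted : Subset n → Fin n → Set
  Rooted A o = o ∈ A × (∀ {a} → a ∈ A → Star (In.Step A) a o)

  -- The boundary of a connected union of blocks.

  module _ (G : Graph n) (conn : IsVertexConnected G 2)
           (covered : ∀ {u v} → Graph._~_ G u v → ∃ λ i → κ i u ≡ κ i v) where
    open Graph G

    crossing : ∀ {A u w} → u ~ w → u ∉ A → w ∈ A → w ∈ ∂ A × Out.Step A u w
    crossing {A} uw u∉A w∈A with covered uw
    ... | i , eq = ∈⟦⟧⁺ (∂? A) (w∈A , i , λ within → u∉A (within _ eq)) ,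
                   i , eq , λ within → u∉A (within _ refl)

    -- Up to its first vertex in `A`, every step of the walk starts outside `A`, so its block leaves
    -- `A`. `R` is adjacency in the graph or in the graph minus a vertex; in the latter case the
    -- returned last step shows that `w` is not the deleted vertex.
    enter : ∀ {A} {R : Rel (Fin n) 0ℓ} → (∀ {u v} → R u v → u ~ v) →
            ∀ {u a} → Star R u a → u ∉ A → a ∈ A →
            ∃ λ w → w ∈ ∂ A × Star (Out.Step A) u w × ∃ λ z → R z w
    enter R⇒~ ε u∉A u∈A = ⊥-elim (u∉A u∈A)
    enter {A} R⇒~ (_◅_ {j = w} e s) u∉A a∈A with w ∈? A
    ... | yes w∈A = let w∈∂ , step = crossing (R⇒~ e) u∉A w∈A in w , w∈∂ , step ◅ ε , _ , e
    ... | no  w∉A with enter R⇒~ s w∉A a∈A | covered (R⇒~ e)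
    ...   | x , x∈∂ , t , z | i , eq = x , x∈∂ , (i , eq , (λ within → u∉A (within _ refl))) ◅ t , z

    -- With the whole vertex set as `A` every block is inner, and since the graph is connected one
    -- root suffices.
    rank-lower : Fin n → n ≤ 1 + length spokes
    rank-lower o = begin
      n                             ≡⟨ ∣⊤∣≡n n ⟨
      ∣ ⊤ {n} ∣                     ≤⟨ step-bound ⊤ ⁅ o ⁆ (λ {a} _ → o , x∈⁅x⁆ o , Star.map step (connected G conn a o)) ⟩
      ∣ ⁅ o ⁆ ∣ + length chosen     ≤⟨ ℕ.+-mono-≤ (ℕ.≤-reflexive (∣⁅x⁆∣≡1 o)) (List.length-filter chosen? spokes) ⟩
      1 + length spokes             ∎
      where
      open ℕ.≤-Reasoning
      open In ⊤
      step : ∀ {u v} → u ~ v → Step u v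
      step e = let i , eq = covered e in i , eq , λ _ _ → ∈⊤

    -- The smallest and the largest element of ∂ A in each outer component form two disjoint sets of
    -- representatives, so one of them has at most half the size of ∂ A.
    module _ {A : Subset n} {o o′ : Fin n} (rooted : Rooted A o) (o′∈A : o′ ∈ A) (o≢o′ : o ≢ o′) where
      open Out A using (Step; step?; step-sym)

      private
        module Min = Extremal step? (∂ A) Fin._<?_
        module Max = Extremal step? (∂ A) (λ u v → v Fin.<? u)

      -- The absence of cut vertices enters here: a block at `p` contains some `u` outside `A`, and
      -- `u` can walk to another vertex of `A` while avoiding `p`. It enters `A` at a second
      -- boundary vertex of the same outer component.
      not-alone : ∀ {p} → p ∈ ∂ A → ∃ λ q → q ∈ ∂ A × q ≢ p × Star Step p q
      not-alone {p} p∈∂ with ∈⟦⟧⁻ (∂? A) p∈∂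
      ... | p∈A , i , ¬within with escape ¬within
      ...   | u , eq , u∉A = towards (other (o Fin.≟ p))
        where
        other : Dec (o ≡ p) → ∃ λ a → a ∈ A × a ≢ p
        other (yes o≡p) = o′ , o′∈A , λ o′≡p → o≢o′ (trans o≡p (sym o′≡p))
        other (no  o≢p) = o , proj₁ rooted , o≢p
        towards : (∃ λ a → a ∈ A × a ≢ p) → ∃ λ q → q ∈ ∂ A × q ≢ p × Star Step p q
        towards (a , a∈A , a≢p)
          with enter {R = λ a b → _~[-_]_ G a ⁅ p ⁆ b} (proj₂ ∘ proj₂)
                 (connected-without G conn p u a (λ { refl → u∉A p∈A }) a≢p) u∉A a∈A
        ... | w , w∈∂ , s , z , (_ , w∉⁅p⁆ , _) =
          w , w∈∂ , (λ { refl → w∉⁅p⁆ (x∈⁅x⁆ p) }) , ((i , sym eq , ¬within) ◅ s)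

      -- The inner spokes connect `A`; the outer ones connect the complement and the boundary to
      -- either set of representatives. Averaging the two outer counts leaves half of `∣ ∂ A ∣` as
      -- surplus.
      boundary-bound : ∣ ∂ A ∣ + 2 * n ≤ 2 + 2 * length spokes
      boundary-bound = double-count
        {n} {∣ A ∣} {∣ ∁ A ∣} {∣ ∂ A ∣} {length (In.chosen A)} {length (Out.chosen A)}
        {∣ Min.extremal ∣} {∣ Max.extremal ∣}
        n≤ inner
        (outer Min.extremal (Min.reach-extremal <-wellFounded))
        (outer Max.extremal (Max.reach-extremal >-wellFounded))
        extremes (length-filter-¬ (In.chosen? A) spokes)
        where
        n≤ : n ≤ ∣ A ∣ + ∣ ∁ A ∣
        n≤ = subst (_≤ ∣ A ∣ + ∣ ∁ A ∣) (trans (cong ∣_∣ (p∪∁p≡⊤ A)) (∣⊤∣≡n n)) (∣p∪q∣≤∣p∣+∣q∣ A (∁ A))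
        inner : ∣ A ∣ ≤ 1 + length (In.chosen A)
        inner = subst (λ k → ∣ A ∣ ≤ k + length (In.chosen A)) (∣⁅x⁆∣≡1 o)
                  (In.step-bound A A ⁅ o ⁆ λ a∈A → o , x∈⁅x⁆ o , proj₂ rooted a∈A)
        outer : ∀ P → (∀ {p} → p ∈ ∂ A → ∃ λ q → q ∈ P × Star Step p q) →
                ∣ ∁ A ∣ + ∣ ∂ A ∣ ≤ ∣ P ∣ + length (Out.chosen A)
        outer P reach = ℕ.≤-trans
          (disjoint⇒∣p∣+∣q∣≤∣d∣ (∁ A) (∂ A) (∁ A ∪ ∂ A) (p⊆p∪q (∂ A)) (q⊆p∪q (∁ A) (∂ A))
            λ x∈∁A x∈∂ → x∈∁p⇒x∉p x∈∁A (proj₁ (∈⟦⟧⁻ (∂? A) x∈∂)))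
          (Out.step-bound A (∁ A ∪ ∂ A) P ([ from-∁ , reach ]′ ∘ x∈p∪q⁻ (∁ A) (∂ A)))
          where
          from-∁ : ∀ {a} → a ∈ ∁ A → ∃ λ q → q ∈ P × Star Step a q
          from-∁ {a} a∈∁A with enter id (connected G conn a o) (x∈∁p⇒x∉p a∈∁A) (proj₁ rooted)
          ... | w , w∈∂ , s , _ with reach w∈∂
          ...   | q , q∈P , t = q , q∈P , (s ◅◅ t)
        extremes : ∣ Min.extremal ∣ + ∣ Max.extremal ∣ ≤ ∣ ∂ A ∣
        extremes = disjoint⇒∣p∣+∣q∣≤∣d∣ Min.extremal Max.extremal (∂ A)
          Min.extremal⊆ Max.extremal⊆ distinct
          where
          -- A vertex both least and greatest would be the only boundary vertex of its component,
          -- against `not-alone`.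
          distinct : ∀ {x} → x ∈ Min.extremal → x ∉ Max.extremal
          distinct {x} x∈min x∈max =
            let y , y∈∂ , y≢x , s = not-alone (Min.extremal⊆ x∈min) in
            compare y≢x (Min.extremal-least x∈min y∈∂ s) (Max.extremal-least x∈max y∈∂ s)
            where
            compare : ∀ {x y : Fin n} → y ≢ x → ¬ y Fin.< x → ¬ x Fin.< y → ⊥
            compare {x} {y} y≢x y≮x x≮y with Fin.<-cmp y x
            ... | tri< y<x _ _ = y≮x y<x
            ... | tri≈ _ y≡x _ = y≢x y≡x
            ... | tri> _ _ x<y = x≮y x<y

-- Numerical estimates for the growth.

subset-of-size : ∀ {k} → k ≤ n → ∃ λ (p : Subset n) → ∣ p ∣ ≡ k
subset-of-size {n} z≤n   = Subset.⊥ , ∣⊥∣≡0 n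
subset-of-size (s≤s k≤n) = let p , eq = subset-of-size k≤n in inside ∷ p , cong suc eq

n≤3*⌊n/2⌋ : ∀ n → 2 ≤ n → n ≤ 3 * ⌊ n /2⌋
n≤3*⌊n/2⌋ (suc zero) (s≤s ())
n≤3*⌊n/2⌋ 2 _ = s≤s (s≤s z≤n)
n≤3*⌊n/2⌋ 3 _ = s≤s (s≤s (s≤s z≤n))
n≤3*⌊n/2⌋ (suc (suc m@(suc (suc k)))) _ = begin
  2 + m                     ≤⟨ ℕ.+-mono-≤ (s≤s (s≤s (z≤n {1}))) (n≤3*⌊n/2⌋ m (s≤s (s≤s z≤n))) ⟩
  3 + 3 * ⌊ m /2⌋           ≡⟨ ℕ.*-suc 3 ⌊ m /2⌋ ⟨
  3 * suc ⌊ m /2⌋           ∎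
  where open ℕ.≤-Reasoning

2*⌊n/2⌋≤n : ∀ n → 2 * ⌊ n /2⌋ ≤ n
2*⌊n/2⌋≤n n = begin
  2 * ⌊ n /2⌋               ≡⟨ cong (⌊ n /2⌋ +_) (ℕ.+-identityʳ ⌊ n /2⌋) ⟩
  ⌊ n /2⌋ + ⌊ n /2⌋         ≤⟨ ℕ.+-monoʳ-≤ ⌊ n /2⌋ (ℕ.⌊n/2⌋≤⌈n/2⌉ n) ⟩
  ⌊ n /2⌋ + ⌈ n /2⌉         ≡⟨ ℕ.⌊n/2⌋+⌈n/2⌉≡n n ⟩
  n                         ∎
  where open ℕ.≤-Reasoning

∣p∣+∣∁p∣≡n : (p : Subset n) → ∣ p ∣ + ∣ ∁ p ∣ ≡ n
∣p∣+∣∁p∣≡n p = trans (cong (∣ p ∣ +_) (∣∁p∣≡n∸∣p∣ p)) (ℕ.m+[n∸m]≡n (∣p∣≤n p))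

-- In the next two lemmas a and a′ are the sizes of a set before and after a block of size k is
-- added; e, b and c are the sizes of the complement, boundary and interior of the new set.

final-step : ∀ n d a a′ k e → 1 ≤ n → 16 * a ≤ 3 * n → 2 * k ≤ n + d → a′ ≤ a + k → a′ + e ≡ n →
             16 * d ≤ n → ¬ 32 * e ≤ n
final-step n d a a′ k e 1≤n a≤ k≤ a′≤ refl d≤ e≤ = ℕ.<⇒≱ 24n<32n bound
  where
  open ℕ.≤-Reasoning
  24n<32n : 24 * n < 32 * n
  24n<32n = ℕ.*-monoˡ-< n {{ℕ.>-nonZero 1≤n}} (ℕ.m≤m+n 25 7)
  expand : ∀ a k e → 32 * (a + k + e) ≡ 2 * (16 * a) + 16 * (2 * k) + 32 * e
  expand = solve-∀
  collect : ∀ n d → 2 * (3 * n) + 16 * (n + d) + n ≡ 23 * n + 16 * d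
  collect = solve-∀
  add : ∀ n → 23 * n + n ≡ 24 * n
  add = solve-∀
  -- In units of n / 32, the old set, the block and the complement are at most 6, 17 and 1; the
  -- block uses d ≤ n / 16.
  bound : 32 * n ≤ 24 * n
  bound = begin
    32 * n                                   ≤⟨ ℕ.*-monoʳ-≤ 32 (ℕ.+-monoˡ-≤ e a′≤) ⟩
    32 * (a + k + e)                         ≡⟨ expand a k e ⟩
    2 * (16 * a) + 16 * (2 * k) + 32 * e
      ≤⟨ ℕ.+-mono-≤ (ℕ.+-mono-≤ (ℕ.*-monoʳ-≤ 2 a≤) (ℕ.*-monoʳ-≤ 16 k≤)) e≤ ⟩
    2 * (3 * n) + 16 * (n + d) + n           ≡⟨ collect n d ⟩
    23 * n + 16 * d                          ≤⟨ ℕ.+-monoʳ-≤ (23 * n) d≤ ⟩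
    23 * n + n                               ≡⟨ add n ⟩
    24 * n                                   ∎

next-step : ∀ n d a′ b c → a′ ≤ c + b → b ≤ 2 * d → 16 * d ≤ n → 32 * c ≤ n → 16 * a′ ≤ 3 * n
-- In units of n / 32, interior and boundary give at most 1 + 4, below the threshold 6.
next-step n d a′ b c a′≤ b≤ d≤ c≤ = ℕ.*-cancelˡ-≤ 2 (begin
  2 * (16 * a′)                ≤⟨ ℕ.*-monoʳ-≤ 2 (ℕ.*-monoʳ-≤ 16 (ℕ.≤-trans a′≤ (ℕ.+-monoʳ-≤ c b≤))) ⟩
  2 * (16 * (c + 2 * d))       ≡⟨ expand c d ⟩
  32 * c + 4 * (16 * d)        ≤⟨ ℕ.+-mono-≤ c≤ (ℕ.*-monoʳ-≤ 4 d≤) ⟩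
  n + 4 * n                    ≤⟨ ℕ.m≤m+n _ n ⟩
  n + 4 * n + n                ≡⟨ add n ⟩
  2 * (3 * n)                  ∎)
  where
  open ℕ.≤-Reasoning
  expand : ∀ c d → 2 * (16 * (c + 2 * d)) ≡ 32 * c + 4 * (16 * d)
  expand = solve-∀
  add : ∀ n → n + 4 * n + n ≡ 2 * (3 * n)
  add = solve-∀

-- Growing a union of blocks under expansion.

module Growth (κ : Fin r → Fin n → Fin n)
              (G : Graph n) (conn : IsVertexConnected G 2)
              (covered : ∀ {u v} → Graph._~_ G u v → ∃ λ i → κ i u ≡ κ i v)
              (2≤r : 2 ≤ r) (d : ℕ)
              (expanding : ∀ U → 2 * ∣ U ∣ ≤ n → 64 * d * ∣ U ∣ ≤ n * ∣ N G U ∣)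
              (small-rank : ∀ i → r * Blocks.ρ κ i + 2 ≤ n + d) where
  open Graph G
  open Blocks κ

  2≤n : 2 ≤ n
  2≤n = ℕ.<⇒≤ (proj₁ conn)

  spokes≤ : length spokes + 2 ≤ n + d
  spokes≤ = subst (length spokes + 2 ≤_) (ℕ.m∸n+n≡m (ℕ.≤-trans 2≤n (ℕ.m≤m+n n d)))
    (ℕ.+-monoˡ-≤ 2 (ℕ.*-cancelˡ-≤ r {{ℕ.>-nonZero (ℕ.<⇒≤ 2≤r)}}
      (spokes-bound λ i → ℕ.m+n≤o⇒m≤o∸n (r * ρ i) (small-rank i))))

  -- Connectedness forces at least n - 1 spokes, whereas small ranks allow only n + d - 2.
  1≤d : 1 ≤ d
  1≤d = ℕ.+-cancelˡ-≤ n 1 d (begin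
    n + 1                     ≤⟨ ℕ.+-monoˡ-≤ 1 (rank-lower G conn covered (Fin.fromℕ< 2≤n)) ⟩
    1 + length spokes + 1     ≡⟨ shift (length spokes) ⟩
    length spokes + 2         ≤⟨ spokes≤ ⟩
    n + d                     ∎)
    where
    open ℕ.≤-Reasoning
    shift : ∀ x → 1 + x + 1 ≡ x + 2
    shift = solve-∀

  -- Expansion is tested on a set of ⌊n/2⌋ ≥ n / 3 vertices, whose neighbourhood has at most n; the
  -- resulting 64 d / 3 ≤ n is weakened to a round constant.
  16d≤n : 16 * d ≤ n
  16d≤n with subset-of-size (ℕ.⌊n/2⌋≤n n)
  ... | U , eq = ℕ.*-cancelˡ-≤ n {{ℕ.>-nonZero (ℕ.<⇒≤ 2≤n)}} (ℕ.*-cancelˡ-≤ 3 (begin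
    3 * (n * (16 * d))               ≡⟨ shift n d ⟩
    48 * d * n                       ≤⟨ ℕ.*-monoˡ-≤ n (ℕ.*-monoˡ-≤ d (ℕ.m≤m+n 48 16)) ⟩
    64 * d * n                       ≤⟨ ℕ.*-monoʳ-≤ (64 * d) (n≤3*⌊n/2⌋ n 2≤n) ⟩
    64 * d * (3 * ⌊ n /2⌋)           ≡⟨ swap (64 * d) ⌊ n /2⌋ ⟩
    3 * (64 * d * ⌊ n /2⌋)           ≡⟨ cong (λ h → 3 * (64 * d * h)) eq ⟨
    3 * (64 * d * ∣ U ∣)
      ≤⟨ ℕ.*-monoʳ-≤ 3 (expanding U (subst (λ h → 2 * h ≤ n) (sym eq) (2*⌊n/2⌋≤n n))) ⟩
    3 * (n * ∣ N G U ∣)              ≤⟨ ℕ.*-monoʳ-≤ 3 (ℕ.*-monoʳ-≤ n (∣p∣≤n (N G U))) ⟩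
    3 * (n * n)                      ∎))
    where
    open ℕ.≤-Reasoning
    shift : ∀ n d → 3 * (n * (16 * d)) ≡ 48 * d * n
    shift = solve-∀
    swap : ∀ x h → x * (3 * h) ≡ 3 * (x * h)
    swap = solve-∀

  -- Expansion gives 64 d `∣ U ∣` ≤ 2 d n, and 2 d cancels because d is positive.
  small-side : ∀ U → ∣ N G U ∣ ≤ 2 * d → 2 * ∣ U ∣ ≤ n → 32 * ∣ U ∣ ≤ n
  small-side U N≤ U≤ = ℕ.*-cancelˡ-≤ (2 * d) {{ℕ.>-nonZero (ℕ.≤-trans 1≤d (ℕ.m≤m+n d _))}} (begin
    2 * d * (32 * ∣ U ∣)      ≡⟨ shift d ∣ U ∣ ⟩
    64 * d * ∣ U ∣            ≤⟨ expanding U U≤ ⟩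
    n * ∣ N G U ∣             ≤⟨ ℕ.*-monoʳ-≤ n N≤ ⟩
    n * (2 * d)               ≡⟨ ℕ.*-comm n (2 * d) ⟩
    2 * d * n                 ∎)
    where
    open ℕ.≤-Reasoning
    shift : ∀ d u → 2 * d * (32 * u) ≡ 64 * d * u
    shift = solve-∀

  -- N G U reduces to ⟦ nbr? U ⟧.
  nbr? : ∀ U v → Dec (v ∉ U × ∃ λ u → u ∈ U × u ~ v)
  nbr? U v = ¬? (v ∈? U) ×-dec any? λ u → (u ∈? U) ×-dec (u ~? v)

  N-∁⊆∂ : ∀ A → N G (∁ A) ⊆ ∂ A
  N-∁⊆∂ A x∈N with ∈⟦⟧⁻ (nbr? (∁ A)) x∈N
  ... | x∉∁A , u , u∈∁A , ux =
    proj₁ (crossing G conn covered ux (x∈∁p⇒x∉p u∈∁A) (x∉∁p⇒x∈p x∉∁A))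

  interior? : ∀ A v → Dec (v ∈ A × v ∉ ∂ A)
  interior? A v = (v ∈? A) ×-dec ¬? (v ∈? ∂ A)

  interior : Subset n → Subset n
  interior A = ⟦ interior? A ⟧

  -- A neighbour of `u` outside `A` would put `u` itself on the boundary by `crossing`.
  N-interior⊆∂ : ∀ A → N G (interior A) ⊆ ∂ A
  N-interior⊆∂ A {x} x∈N with ∈⟦⟧⁻ (nbr? (interior A)) x∈N
  ... | x∉int , u , u∈int , ux with ∈⟦⟧⁻ (interior? A) u∈int | x ∈? A | x ∈? ∂ A
  ... | _           | _       | yes x∈∂ = x∈∂
  ... | _           | yes x∈A | no  x∉∂ = ⊥-elim (x∉int (∈⟦⟧⁺ (interior? A) (x∈A , x∉∂)))
  ... | u∈A , u∉∂   | no  x∉A | no  _   = ⊥-elim (u∉∂ (proj₁ (crossing G conn covered (~-sym ux) x∉A u∈A)))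

  ∣A∣≤∣interior∣+∣∂∣ : ∀ A → ∣ A ∣ ≤ ∣ interior A ∣ + ∣ ∂ A ∣
  ∣A∣≤∣interior∣+∣∂∣ A = ℕ.≤-trans (p⊆q⇒∣p∣≤∣q∣ cover) (∣p∪q∣≤∣p∣+∣q∣ (interior A) (∂ A))
    where
    cover : A ⊆ interior A ∪ ∂ A
    cover {x} x∈A with x ∈? ∂ A
    ... | yes x∈∂ = x∈p∪q⁺ (inj₂ x∈∂)
    ... | no  x∉∂ = x∈p∪q⁺ (inj₁ (∈⟦⟧⁺ (interior? A) (x∈A , x∉∂)))

  block : Fin r → Fin n → Subset n
  block i u = ⟦ (λ x → κ i x Fin.≟ κ i u) ⟧

  -- At most one vertex of a block is fixed, namely the common value, so the size is at most ρ i +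
  -- 1; then r ≥ 2 is used.
  block-size : ∀ i u → 2 * ∣ block i u ∣ ≤ n + d
  block-size i u = begin
    2 * ∣ block i u ∣         ≤⟨ ℕ.*-monoʳ-≤ 2 (p⊆q⇒∣p∣≤∣q∣ cover) ⟩
    2 * ∣ unfixed (κ i) ∪ ⁅ κ i u ⁆ ∣ ≤⟨ ℕ.*-monoʳ-≤ 2 (∣p∪⁅x⁆∣≤1+∣p∣ (unfixed (κ i)) (κ i u)) ⟩
    2 * suc (ρ i)             ≡⟨ ℕ.*-suc 2 (ρ i) ⟩
    2 + 2 * ρ i               ≤⟨ ℕ.+-monoʳ-≤ 2 (ℕ.*-monoˡ-≤ (ρ i) 2≤r) ⟩
    2 + r * ρ i               ≡⟨ ℕ.+-comm 2 (r * ρ i) ⟩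
    r * ρ i + 2               ≤⟨ small-rank i ⟩
    n + d                     ∎
    where
    open ℕ.≤-Reasoning
    cover : block i u ⊆ unfixed (κ i) ∪ ⁅ κ i u ⁆
    cover {x} x∈ with ∈⟦⟧⁻ (λ x → κ i x Fin.≟ κ i u) x∈ | κ i x Fin.≟ x
    ... | eq | yes fixed = x∈p∪q⁺ (inj₂ (subst (_∈ ⁅ κ i u ⁆) (trans (sym eq) fixed) (x∈⁅x⁆ (κ i u))))
    ... | _  | no  ≢x    = x∈p∪q⁺ (inj₁ (∈⟦⟧⁺ (unfixed? (κ i)) ≢x))

  leaving-edge : ∀ {A u x} → Star _~_ u x → u ∈ A → x ∉ A → ∃₂ λ v w → v ∈ A × w ∉ A × v ~ w
  leaving-edge ε u∈A u∉A = ⊥-elim (u∉A u∈A)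
  leaving-edge {A} (_◅_ {j = w} e s) u∈A x∉A with w ∈? A
  ... | yes w∈A = leaving-edge s w∈A x∉A
  ... | no  w∉A = _ , w , u∈A , w∉A , e

  outsider : ∀ {A} → ∣ A ∣ < n → ∃ λ x → x ∉ A
  outsider {A} A<n with any? (λ x → ¬? (x ∈? A))
  ... | yes x = x
  ... | no ¬x = ⊥-elim (ℕ.<⇒≱ A<n (subst (_≤ ∣ A ∣) (∣⊤∣≡n n) (p⊆q⇒∣p∣≤∣q∣ {n} ⊤⊆A)))
    where
    ⊤⊆A : ⊤ {n} ⊆ A
    ⊤⊆A {x} _ with x ∈? A
    ... | yes x∈A = x∈A
    ... | no  x∉A = ⊥-elim (¬x (x , x∉A))

  small⇒proper : ∀ a → 16 * a ≤ 3 * n → a < n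
  small⇒proper a a≤ = ℕ.*-cancelˡ-< 16 a n (ℕ.≤-<-trans a≤
    (ℕ.*-monoˡ-< n {{ℕ.>-nonZero (ℕ.<⇒≤ 2≤n)}} (ℕ.m≤m+n 4 12)))

  add-block : ∀ {A o i u} → Rooted A o → u ∈ A → Rooted (A ∪ block i u) o
  add-block {A} {o} {i} {u} (o∈A , walk) u∈A = x∈p∪q⁺ (inj₁ o∈A) , ([ old , new ]′ ∘ x∈p∪q⁻ A (block i u))
    where
    old : ∀ {a} → a ∈ A → Star (In.Step (A ∪ block i u)) a o
    old a∈A = Star.map (λ (j , eq , within) → j , eq , λ w e → x∈p∪q⁺ (inj₁ (within w e))) (walk a∈A)
    new : ∀ {a} → a ∈ block i u → Star (In.Step (A ∪ block i u)) a o
    new a∈K = let eq = ∈⟦⟧⁻ (λ x → κ i x Fin.≟ κ i u) a∈K in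
      (i , eq , λ w e → x∈p∪q⁺ (inj₂ (∈⟦⟧⁺ (λ x → κ i x Fin.≟ κ i u) (trans e eq)))) ◅ old u∈A

  ∂-bound : ∀ {A o o′} → Rooted A o → o′ ∈ A → o ≢ o′ → ∣ ∂ A ∣ ≤ 2 * d
  ∂-bound {A} rooted o′∈A o≢o′ = ℕ.+-cancelʳ-≤ (2 + 2 * n) _ _ (begin
    ∣ ∂ A ∣ + (2 + 2 * n)           ≡⟨ shift ∣ ∂ A ∣ n ⟩
    2 + (∣ ∂ A ∣ + 2 * n)           ≤⟨ ℕ.+-monoʳ-≤ 2 (boundary-bound G conn covered rooted o′∈A o≢o′) ⟩
    2 + (2 + 2 * length spokes)     ≡⟨ collect (length spokes) ⟩
    2 * (length spokes + 2)         ≤⟨ ℕ.*-monoʳ-≤ 2 spokes≤ ⟩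
    -- The count really gives 2 d - 2; this step rounds it up to 2 d.
    2 * (n + d)                     ≤⟨ ℕ.m≤n+m _ 2 ⟩
    2 + 2 * (n + d)                 ≡⟨ expand n d ⟩
    2 * d + (2 + 2 * n)             ∎)
    where
    open ℕ.≤-Reasoning
    shift : ∀ b n → b + (2 + 2 * n) ≡ 2 + (b + 2 * n)
    shift = solve-∀
    collect : ∀ s → 2 + (2 + 2 * s) ≡ 2 * (s + 2)
    collect = solve-∀
    expand : ∀ n d → 2 + 2 * (n + d) ≡ 2 * d + (2 + 2 * n)
    expand = solve-∀

  -- The fuel `k` bounds the number of vertices outside `A`, and `A` keeps at most 3 n / 16
  -- vertices. If the complement of the enlarged set is still more than half, the interior is tiny
  -- and the size bound is restored; otherwise the complement is tiny and one block would have
  -- supplied more vertices than a block can have.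
  grow : ∀ k A o → n ≤ ∣ A ∣ + k → Rooted A o → 16 * ∣ A ∣ ≤ 3 * n → ⊥
  grow zero A o n≤ _ small =
    ℕ.<⇒≱ (small⇒proper ∣ A ∣ small) (subst (n ≤_) (ℕ.+-identityʳ ∣ A ∣) n≤)
  grow (suc k) A o n≤ rooted small =
    let x , x∉A = outsider (small⇒proper ∣ A ∣ small)
        u , w , u∈A , w∉A , uw = leaving-edge (connected G conn o x) (proj₁ rooted) x∉A
        i , eq = covered uw
    in extend i u w u∈A w∉A eq
    where
    module _ (i : Fin r) (u w : Fin n) (u∈A : u ∈ A) (w∉A : w ∉ A) (eq : κ i u ≡ κ i w) where
      A′ : Subset n
      A′ = A ∪ block i u
      w∈A′ : w ∈ A′
      w∈A′ = x∈p∪q⁺ (inj₂ (∈⟦⟧⁺ (λ x → κ i x Fin.≟ κ i u) (sym eq)))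
      bigger : ∣ A ∣ < ∣ A′ ∣
      bigger = p⊂q⇒∣p∣<∣q∣ (p⊆p∪q (block i u) , w , w∈A′ , w∉A)
      rooted′ : Rooted A′ o
      rooted′ = add-block rooted u∈A
      ∂≤ : ∣ ∂ A′ ∣ ≤ 2 * d
      -- The required second vertex is `w`: it lies outside `A`, so it differs from the root.
      ∂≤ = ∂-bound rooted′ w∈A′ λ o≡w → w∉A (subst (_∈ A) o≡w (proj₁ rooted))
      extend : ⊥
      extend with 2 * ∣ ∁ A′ ∣ ≤? n
      ... | yes half = final-step n d (∣ A ∣) (∣ A′ ∣) (∣ block i u ∣) (∣ ∁ A′ ∣) (ℕ.<⇒≤ 2≤n) small (block-size i u)
              (∣p∪q∣≤∣p∣+∣q∣ A (block i u)) (∣p∣+∣∁p∣≡n A′) 16d≤n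
              (small-side (∁ A′) (ℕ.≤-trans (p⊆q⇒∣p∣≤∣q∣ (N-∁⊆∂ A′)) ∂≤) half)
      ... | no ¬half = grow k A′ o
              (ℕ.≤-trans n≤ (ℕ.≤-trans (ℕ.≤-reflexive (ℕ.+-suc ∣ A ∣ k)) (ℕ.+-monoˡ-≤ k bigger)))
              rooted′
              (next-step n d (∣ A′ ∣) (∣ ∂ A′ ∣) (∣ interior A′ ∣) (∣A∣≤∣interior∣+∣∂∣ A′) ∂≤ 16d≤n
                (small-side (interior A′) (ℕ.≤-trans (p⊆q⇒∣p∣≤∣q∣ (N-interior⊆∂ A′)) ∂≤)
                  (ℕ.≤-trans (ℕ.*-monoʳ-≤ 2 (p⊆q⇒∣p∣≤∣q∣ (proj₁ ∘ ∈⟦⟧⁻ (interior? A′))))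
                    (other-half (∣ A′ ∣) (∣ ∁ A′ ∣) (∣p∣+∣∁p∣≡n A′) (ℕ.<⇒≤ (ℕ.≰⇒> ¬half))))))
        where
        other-half : ∀ a e → a + e ≡ n → n ≤ 2 * e → 2 * a ≤ n
        other-half a e refl n≤2e = ℕ.+-cancelˡ-≤ (a + e) _ _ (begin
          a + e + 2 * a          ≤⟨ ℕ.+-monoˡ-≤ (2 * a) n≤2e ⟩
          2 * e + 2 * a          ≡⟨ regroup a e ⟩
          a + e + (a + e)        ∎)
          where
          open ℕ.≤-Reasoning
          regroup : ∀ a e → 2 * e + 2 * a ≡ a + e + (a + e)
          regroup = solve-∀

  absurd : ⊥
  -- A singleton meets the size bound because 16 ≤ 16 d ≤ n.
  absurd = grow n ⁅ o ⁆ o (ℕ.m≤n+m n _)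
    (x∈⁅x⁆ o , λ a∈ → subst (λ a → Star (In.Step ⁅ o ⁆) a o) (sym (x∈⁅y⁆⇒x≡y o a∈)) ε)
    (begin
      16 * ∣ ⁅ o ⁆ ∣         ≡⟨ cong (16 *_) (∣⁅x⁆∣≡1 o) ⟩
      16 * 1                 ≤⟨ ℕ.*-monoʳ-≤ 16 1≤d ⟩
      16 * d                 ≤⟨ 16d≤n ⟩
      n                      ≤⟨ ℕ.m≤m+n n _ ⟩
      3 * n                  ∎)
    where
    open ℕ.≤-Reasoning
    o = Fin.fromℕ< 2≤n

-- Greedy forests and spanning trees.

module Trees (G : Graph n) where
  open Graph G

  source target : Edge G → Fin n
  source e = proj₁ (lookup (edges G) e)
  target e = proj₂ (lookup (edges G) e)

  edge-of : ∀ {u v} → u ~ v → ∃ λ e → Joins G e u v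
  edge-of {u} {v} uv with Fin.<-cmp u v
  ... | tri≈ _ refl _ = ⊥-elim (~-irrefl refl uv)
  ... | tri< u<v _ _ = Any.index i , inj₁ (sym (lookup-index i))
    where
    i : (u , v) List.∈ edges G
    i = ∈-filter⁺ (isEdge? G) (∈-cartesianProduct⁺ (∈-allFin u) (∈-allFin v)) (u<v , uv)
  ... | tri> _ _ v<u = Any.index i , inj₂ (sym (lookup-index i))
    where
    i : (v , u) List.∈ edges G
    i = ∈-filter⁺ (isEdge? G) (∈-cartesianProduct⁺ (∈-allFin v) (∈-allFin u)) (v<u , ~-sym uv)

  adj-sym : ∀ T {u v} → Adj G T u v → Adj G T v u
  adj-sym T (e , e∈T , j) = e , e∈T , [ inj₂ , inj₁ ]′ j

  adj-mono : ∀ {T T′} → T ⊆ T′ → ∀ {u v} → Adj G T u v → Adj G T′ u v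
  adj-mono T⊆T′ (e , e∈T , j) = e , T⊆T′ e∈T , j

  -- For the components of a forest, such an edge either belongs to the forest or would close a
  -- cycle.
  Levels : (Fin n → Fin n) → Edge G → Set
  Levels κ e = κ (source e) ≡ κ (target e)

  levels⇒≡ : ∀ κ {e u v} → Levels κ e → Joins G e u v → κ u ≡ κ v
  levels⇒≡ κ level (inj₁ eq) = trans (cong (κ ∘ proj₁) (sym eq)) (trans level (cong (κ ∘ proj₂) eq))
  levels⇒≡ κ level (inj₂ eq) = sym (trans (cong (κ ∘ proj₁) (sym eq)) (trans level (cong (κ ∘ proj₂) eq)))

  -- κ v represents the component of v in (V, T); lower and upper say that T has n − c edges,
  -- where c is the number of components.
  record IsForest (T : EdgeSet G) (κ : Fin n → Fin n) : Set where
    field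
      idem   : ∀ v → κ (κ v) ≡ κ v
      to-rep : ∀ v → Star (Adj G T) v (κ v)
      levels : ∀ {e} → e ∈ T → Levels κ e
      lower  : ∣ unfixed κ ∣ ≤ ∣ T ∣
      upper  : ∣ T ∣ ≤ ∣ unfixed κ ∣

  empty-forest : IsForest Subset.⊥ id
  empty-forest = record
    { idem = λ _ → refl ; to-rep = λ _ → ε ; levels = ⊥-elim ∘ ∉⊥
    ; lower = ℕ.≤-trans (p⊆q⇒∣p∣≤∣q∣ {n} {p = unfixed id} {q = Subset.⊥}
                          (λ x∈ → ⊥-elim (∈⟦⟧⁻ (unfixed? id) x∈ refl)))
                        (ℕ.≤-reflexive (trans (∣⊥∣≡0 n) (sym (∣⊥∣≡0 m))))
    ; upper = ℕ.≤-trans (ℕ.≤-reflexive (∣⊥∣≡0 m)) z≤n }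
    where
    m : ℕ
    m = length (edges G)

  -- The component of `y` takes over the representative of `x`. The only vertex that becomes unfixed
  -- is `κ y`, so the rank grows by one, as does the number of edges.
  module AddEdge {T κ} (forest : IsForest T κ) (e : Edge G) (¬level : ¬ Levels κ e) where
    open IsForest forest

    x y : Fin n
    x = source e
    y = target e

    κ′ : Fin n → Fin n
    κ′ v with κ v Fin.≟ κ y
    ... | yes _ = κ x
    ... | no  _ = κ v

    κ′-yes : ∀ {v} → κ v ≡ κ y → κ′ v ≡ κ x
    κ′-yes {v} eq with κ v Fin.≟ κ y
    ... | yes _  = refl
    ... | no neq = ⊥-elim (neq eq)

    κ′-no : ∀ {v} → κ v ≢ κ y → κ′ v ≡ κ v
    κ′-no {v} neq with κ v Fin.≟ κ y
    ... | yes eq = ⊥-elim (neq eq)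
    ... | no _   = refl

    coarsens : ∀ {u v} → κ u ≡ κ v → κ′ u ≡ κ′ v
    coarsens {u} {v} eq with κ u Fin.≟ κ y | κ v Fin.≟ κ y
    ... | yes _ | yes _ = refl
    ... | no _  | no _  = eq
    ... | yes p | no ¬q = ⊥-elim (¬q (trans (sym eq) p))
    ... | no ¬p | yes q = ⊥-elim (¬p (trans eq q))

    levels-e : Levels κ′ e
    levels-e = trans (κ′-no ¬level) (sym (κ′-yes refl))

    T′ : EdgeSet G
    T′ = T ∪ ⁅ e ⁆

    idem′ : ∀ v → κ′ (κ′ v) ≡ κ′ v
    idem′ v with κ v Fin.≟ κ y
    ... | yes _ = trans (κ′-no (λ eq → ¬level (trans (sym (idem x)) eq))) (idem x)
    ... | no ¬p = trans (κ′-no (λ eq → ¬p (trans (sym (idem v)) eq))) (idem v)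

    old : ∀ {u v} → Star (Adj G T) u v → Star (Adj G T′) u v
    old = Star.map (adj-mono (p⊆p∪q ⁅ e ⁆))

    to-rep′ : ∀ v → Star (Adj G T′) v (κ′ v)
    to-rep′ v with κ v Fin.≟ κ y
    ... | no _   = old (to-rep v)
    -- The walk runs from `v` to `κ y`, back to `y`, across `e` to `x`, and on to `κ x`.
    ... | yes eq = subst (Star (Adj G T′) v) eq (old (to-rep v)) ◅◅
                   (Star.reverse (adj-sym T′) (old (to-rep y)) ◅◅
                   ((e , x∈p∪q⁺ (inj₂ (x∈⁅x⁆ e)) , inj₂ refl) ◅ old (to-rep x)))

    levels′ : ∀ {e′} → e′ ∈ T′ → Levels κ′ e′
    levels′ e′∈ with x∈p∪q⁻ T ⁅ e ⁆ e′∈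
    ... | inj₁ e′∈T = coarsens (levels e′∈T)
    ... | inj₂ e′∈e = subst (Levels κ′) (sym (x∈⁅y⁆⇒x≡y e e′∈e)) levels-e

    unfixed′⊆ : unfixed κ′ ⊆ unfixed κ ∪ ⁅ κ y ⁆
    unfixed′⊆ {v} v∈ with κ v Fin.≟ v | κ v Fin.≟ κ y
    ... | no ≢v  | _      = x∈p∪q⁺ (inj₁ (∈⟦⟧⁺ (unfixed? κ) ≢v))
    ... | yes eq | yes eq′ = x∈p∪q⁺ (inj₂ (subst (_∈ ⁅ κ y ⁆) (trans (sym eq′) eq) (x∈⁅x⁆ (κ y))))
    ... | yes eq | no neq = ⊥-elim (∈⟦⟧⁻ (unfixed? κ′) v∈ (trans (κ′-no neq) eq))

    κy∈unfixed′ : κ y ∈ unfixed κ′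
    κy∈unfixed′ = ∈⟦⟧⁺ (unfixed? κ′) λ eq → ¬level (trans (sym (κ′-yes (idem y))) eq)

    unfixed⊆unfixed′ : unfixed κ ⊆ unfixed κ′
    unfixed⊆unfixed′ {v} v∈ = ∈⟦⟧⁺ (unfixed? κ′) moves
      where
      moves : κ′ v ≢ v
      moves eq with κ v Fin.≟ κ y
      ... | yes _ = ∈⟦⟧⁻ (unfixed? κ) v∈ (trans (cong κ (sym eq)) (trans (idem x) eq))
      ... | no _  = ∈⟦⟧⁻ (unfixed? κ) v∈ eq

    add : IsForest T′ κ′
    add = record
      { idem = idem′ ; to-rep = to-rep′ ; levels = levels′
      ; lower = begin
          ∣ unfixed κ′ ∣                  ≤⟨ p⊆q⇒∣p∣≤∣q∣ unfixed′⊆ ⟩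
          ∣ unfixed κ ∪ ⁅ κ y ⁆ ∣         ≤⟨ ∣p∪⁅x⁆∣≤1+∣p∣ (unfixed κ) (κ y) ⟩
          suc ∣ unfixed κ ∣               ≤⟨ s≤s lower ⟩
          suc ∣ T ∣                       ≡⟨ ℕ.+-comm ∣ T ∣ 1 ⟨
          ∣ T ∣ + 1                       ≡⟨ cong (∣ T ∣ +_) (∣⁅x⁆∣≡1 e) ⟨
          ∣ T ∣ + ∣ ⁅ e ⁆ ∣               ≤⟨ disjoint⇒∣p∣+∣q∣≤∣d∣ T ⁅ e ⁆ T′ (p⊆p∪q ⁅ e ⁆) (q⊆p∪q T ⁅ e ⁆)
                                               (λ e′∈T e′∈e → ¬level (levels (subst (_∈ T) (x∈⁅y⁆⇒x≡y e e′∈e) e′∈T))) ⟩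
          ∣ T′ ∣                          ∎
      ; upper = begin
          ∣ T′ ∣                          ≤⟨ ∣p∪⁅x⁆∣≤1+∣p∣ T e ⟩
          suc ∣ T ∣                       ≤⟨ s≤s upper ⟩
          suc ∣ unfixed κ ∣               ≡⟨ ℕ.+-comm ∣ unfixed κ ∣ 1 ⟨
          ∣ unfixed κ ∣ + 1               ≡⟨ cong (∣ unfixed κ ∣ +_) (∣⁅x⁆∣≡1 (κ y)) ⟨
          ∣ unfixed κ ∣ + ∣ ⁅ κ y ⁆ ∣     ≤⟨ disjoint⇒∣p∣+∣q∣≤∣d∣ (unfixed κ) ⁅ κ y ⁆ (unfixed κ′) unfixed⊆unfixed′
                                               (λ v∈ → subst (_∈ unfixed κ′) (sym (x∈⁅y⁆⇒x≡y (κ y) v∈)) κy∈unfixed′)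
                                               (λ v∈ v∈κy → ∈⟦⟧⁻ (unfixed? κ)
                                                 (subst (_∈ unfixed κ) (x∈⁅y⁆⇒x≡y (κ y) v∈κy) v∈) (idem y)) ⟩
          ∣ unfixed κ′ ∣                  ∎ }
      where open ℕ.≤-Reasoning

  record Extension (T : EdgeSet G) (κ : Fin n → Fin n) (es : List (Edge G)) : Set where
    field
      {T′}     : EdgeSet G
      {κ′}     : Fin n → Fin n
      forest   : IsForest T′ κ′
      grows    : T ⊆ T′
      from     : ∀ {e} → e ∈ T′ → e ∈ T ⊎ e List.∈ es
      covers   : ∀ {e} → e List.∈ es → Levels κ′ e
      coarsens : ∀ {u v} → κ u ≡ κ v → κ′ u ≡ κ′ v

  -- Kruskal's algorithm without weights: an edge inside a component is skipped, and it stays inside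
  -- one because components only merge.
  extend : ∀ {T κ} es → IsForest T κ → Extension T κ es
  extend []       forest = record
    { forest = forest ; grows = id ; from = inj₁ ; covers = λ () ; coarsens = id }
  extend {T} {κ} (e ∷ es) forest with κ (source e) Fin.≟ κ (target e)
  ... | yes level = record
    { forest = X.forest ; grows = X.grows ; from = [ inj₁ , inj₂ ∘ there ]′ ∘ X.from
    ; covers = λ { (here refl) → X.coarsens level ; (there i) → X.covers i } ; coarsens = X.coarsens }
    where module X = Extension (extend es forest)
  ... | no ¬level = record
    { forest = X.forest ; grows = X.grows ∘ p⊆p∪q ⁅ e ⁆
    ; from = [ [ inj₁ , (λ e′∈ → inj₂ (here (x∈⁅y⁆⇒x≡y e e′∈))) ]′ ∘ x∈p∪q⁻ T ⁅ e ⁆ , inj₂ ∘ there ]′ ∘ X.from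
    ; covers = λ { (here refl) → X.coarsens A.levels-e ; (there i) → X.covers i }
    ; coarsens = X.coarsens ∘ A.coarsens }
    where
    module A = AddEdge forest e ¬level
    module X = Extension (extend es A.add)

  connected⇒n≤1+∣T∣ : ∀ {T} → Fin n → Connected (Adj G T) → n ≤ suc ∣ T ∣
  connected⇒n≤1+∣T∣ {T} o conn = begin
    n                               ≡⟨ ∣⊤∣≡n n ⟨
    ∣ ⊤ {n} ∣                       ≤⟨ reach-bound L ⊤ ⁅ o ⁆ (λ {a} _ → o , x∈⁅x⁆ o , Star.map link (conn a o)) ⟩
    ∣ ⁅ o ⁆ ∣ + length L            ≡⟨ cong₂ _+_ (∣⁅x⁆∣≡1 o) (trans (List.length-map _ (elements T)) (length-elements T)) ⟩
    suc ∣ T ∣                       ∎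
    where
    open ℕ.≤-Reasoning
    L : List (Fin n × Fin n)
    L = map (lookup (edges G)) (elements T)
    link : ∀ {u v} → Adj G T u v → Link L u v
    link (e , e∈T , j) =
      Any.map (λ eq → [ (λ k → inj₁ (trans (sym eq) k)) , (λ k → inj₂ (trans (sym eq) k)) ]′ j)
              (∈-map⁺ (lookup (edges G)) (∈-elements e∈T))

  same-ends : ∀ {e u v x y} → Joins G e u v → Joins G e x y → (u ≡ x × v ≡ y) ⊎ (u ≡ y × v ≡ x)
  same-ends (inj₁ p) (inj₁ q) with refl ← trans (sym p) q = inj₁ (refl , refl)
  same-ends (inj₁ p) (inj₂ q) with refl ← trans (sym p) q = inj₂ (refl , refl)
  same-ends (inj₂ p) (inj₁ q) with refl ← trans (sym p) q = inj₂ (refl , refl)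
  same-ends (inj₂ p) (inj₂ q) with refl ← trans (sym p) q = inj₁ (refl , refl)

  -- Vertices of a cycle are distinct, so among its edges only e joins x and c.
  cycle-edge-redundant : ∀ {T x xs} → Connected (Adj G T) → IsCycle (Adj G T) x xs →
                         ∃ λ e → e ∈ T × Connected (Adj G (T - e))
  cycle-edge-redundant {T} {x} {c ∷ c′ ∷ cs} conn
    (_ , ((x≢c ∷ x≢c′ ∷ x≢cs) ∷ (c≢c′ ∷ c≢cs) ∷ _) , ((e , e∈T , j) ∷ link ∷ links)) =
    e , e∈T , λ u v → Star.kleisliStar id replace (conn u v)
    where
    T₀ : EdgeSet G
    T₀ = T - e
    away : ∀ {u v} → x ≢ u → c ≢ u → Adj G T u v → Adj G T₀ u v
    away x≢u c≢u (e′ , e′∈T , j′) = e′ , x∈p∧x≢y⇒x∈p-y e′∈T (λ { refl → absurd (same-ends j′ j) }) , j′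
      where
      absurd : ∀ {v} → (_ ≡ x × v ≡ c) ⊎ (_ ≡ c × v ≡ x) → ⊥
      absurd (inj₁ (eq , _)) = x≢u (sym eq)
      absurd (inj₂ (eq , _)) = c≢u (sym eq)
    back : ∀ {u} ys → x ≢ u → c ≢ u → All (x ≢_) ys → All (c ≢_) ys →
           Linked (Adj G T) (u ∷ (ys ∷ʳ x)) → Star (Adj G T₀) u x
    back []       x≢u c≢u _ _ (l ∷ [-]) = away x≢u c≢u l ◅ ε
    back (y ∷ ys) x≢u c≢u (x≢y ∷ x≢ys) (c≢y ∷ c≢ys) (l ∷ ls) =
      away x≢u c≢u l ◅ back ys x≢y c≢y x≢ys c≢ys ls
    detour : Star (Adj G T₀) c x
    detour = adj-sym T₀ (away x≢c′ c≢c′ (adj-sym T link)) ◅ back cs x≢c′ c≢c′ x≢cs c≢cs links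
    replace : ∀ {u v} → Adj G T u v → Star (Adj G T₀) u v
    replace (e′ , e′∈T , j′) with e′ Fin.≟ e
    ... | no  e′≢e = (e′ , x∈p∧x≢y⇒x∈p-y e′∈T e′≢e , j′) ◅ ε
    ... | yes refl with same-ends j′ j
    ...   | inj₁ (refl , refl) = Star.reverse (adj-sym T₀) detour
    ...   | inj₂ (refl , refl) = detour
  cycle-edge-redundant {xs = []}     _ (() , _)
  cycle-edge-redundant {xs = _ ∷ []} _ (s≤s () , _)

  -- Deleting a redundant edge of a cycle would leave a connected spanning subgraph with at most n -
  -- 2 edges.
  minimal⇒acyclic : ∀ {T} → Fin n → Connected (Adj G T) → ∣ T ∣ < n → Acyclic (Adj G T)
  minimal⇒acyclic o conn T<n (x , xs , cycle) with cycle-edge-redundant conn cycle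
  ... | e , e∈T , conn′ =
    ℕ.<⇒≱ T<n (ℕ.≤-trans (connected⇒n≤1+∣T∣ o conn′) (x∈p⇒∣p-x∣<∣p∣ e∈T))

  -- A greedy pass over the edges of colour `i` gives a maximal forest of that colour, whose size is
  -- the rank. A second pass over all edges completes it to a spanning tree.
  colour-tree : (∀ u v → Star _~_ u v) → Fin n → (f : Edge G → Fin r) (i : Fin r) →
                ∃ λ κ → (∀ v → κ (κ v) ≡ κ v) × (∀ {e} → f e ≡ i → Levels κ e) ×
                ∃ λ T → IsSpanningTree G T × ∣ unfixed κ ∣ ≤ ∣ colourClass G f i ∩ T ∣
  colour-tree conn o f i =
    X.κ′ , IsForest.idem X.forest , (λ eq → X.covers (∈-elements (∈⟦⟧⁺ colour? eq))) ,
    Y.T′ , (spanning , minimal⇒acyclic o spanning few) ,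
    ℕ.≤-trans (IsForest.lower X.forest) (p⊆q⇒∣p∣≤∣q∣ λ e∈ → x∈p∩q⁺ (in-class e∈ , Y.grows e∈))
    where
    colour? : ∀ e → Dec (f e ≡ i)
    colour? e = f e Fin.≟ i
    module X = Extension (extend (elements (colourClass G f i)) empty-forest)
    module Y = Extension (extend (allFin _) X.forest)
    in-class : X.T′ ⊆ colourClass G f i
    in-class e∈ = [ ⊥-elim ∘ ∉⊥ , elements-∈ ]′ (X.from e∈)
    same-rep : ∀ {u v} → Star _~_ u v → Y.κ′ u ≡ Y.κ′ v
    same-rep ε       = refl
    same-rep (a ◅ s) = let e , j = edge-of a in
      trans (levels⇒≡ Y.κ′ (Y.covers (∈-allFin e)) j) (same-rep s)
    spanning : Connected (Adj G Y.T′)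
    spanning u v = subst (Star _ u) (same-rep (conn u v)) (IsForest.to-rep Y.forest u) ◅◅
                   Star.reverse (adj-sym Y.T′) (IsForest.to-rep Y.forest v)
    few : ∣ Y.T′ ∣ < n
    few = begin
      suc ∣ Y.T′ ∣                              ≤⟨ s≤s (IsForest.upper Y.forest) ⟩
      suc ∣ unfixed Y.κ′ ∣                      ≡⟨ ℕ.+-comm ∣ unfixed Y.κ′ ∣ 1 ⟨
      ∣ unfixed Y.κ′ ∣ + 1                      ≡⟨ cong (∣ unfixed Y.κ′ ∣ +_) (∣⁅x⁆∣≡1 (Y.κ′ o)) ⟨
      ∣ unfixed Y.κ′ ∣ + ∣ ⁅ Y.κ′ o ⁆ ∣
        ≤⟨ disjoint⇒∣p∣+∣q∣≤∣d∣ (unfixed Y.κ′) ⁅ Y.κ′ o ⁆ ⊤ (λ _ → ∈⊤) (λ _ → ∈⊤) (λ v∈ v∈o →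
             ∈⟦⟧⁻ (unfixed? Y.κ′) (subst (_∈ unfixed Y.κ′) (x∈⁅y⁆⇒x≡y (Y.κ′ o) v∈o) v∈) (IsForest.idem Y.forest o)) ⟩
      ∣ ⊤ {n} ∣                                 ≡⟨ ∣⊤∣≡n n ⟩
      n                                         ∎
      where open ℕ.≤-Reasoning

-- One tree is taken per colour; if none of them is unbalanced, the ranks are small and `Growth`
-- gives a contradiction. With c tree edges of colour `i`, the last inequality is r c ≥ (n - 1) + d
-- without subtraction.
unbalanced-tree : (G : Graph n) → IsVertexConnected G 2 → 2 ≤ r → (d : ℕ) →
                  (∀ U → 2 * ∣ U ∣ ≤ n → 64 * d * ∣ U ∣ ≤ n * ∣ N G U ∣) →
                  (f : Edge G → Fin r) →
                  ∃₂ λ T i → IsSpanningTree G T × n + d ≤ suc (r * ∣ colourClass G f i ∩ T ∣)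
unbalanced-tree {n} {r} G conn 2≤r d expanding f =
  conclude (any? λ i → n + d ≤? suc (r * ∣ colourClass G f i ∩ T i ∣))
  where
  open Graph G
  open Trees G
  o : Fin n
  o = Fin.fromℕ< (proj₁ conn)
  tree : ∀ i → _
  tree i = colour-tree (connected G conn) o f i
  κ : Fin r → Fin n → Fin n
  κ i = proj₁ (tree i)
  κ-idem : ∀ i v → κ i (κ i v) ≡ κ i v
  κ-idem i = proj₁ (proj₂ (tree i))
  T : Fin r → EdgeSet G
  T i = proj₁ (proj₂ (proj₂ (proj₂ (tree i))))
  T-tree : ∀ i → IsSpanningTree G (T i)
  T-tree i = proj₁ (proj₂ (proj₂ (proj₂ (proj₂ (tree i)))))
  rank≤ : ∀ i → ∣ unfixed (κ i) ∣ ≤ ∣ colourClass G f i ∩ T i ∣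
  rank≤ i = proj₂ (proj₂ (proj₂ (proj₂ (proj₂ (tree i)))))
  covered : ∀ {u v} → u ~ v → ∃ λ i → κ i u ≡ κ i v
  covered uv = let e , j = edge-of uv in
    f e , levels⇒≡ (κ (f e)) (proj₁ (proj₂ (proj₂ (tree (f e)))) refl) j
  conclude : Dec (∃ λ i → n + d ≤ suc (r * ∣ colourClass G f i ∩ T i ∣)) → _
  conclude (yes (i , large)) = T i , i , T-tree i , large
  conclude (no ¬large) = ⊥-elim (Growth.absurd κ G conn covered 2≤r d expanding λ i →
    -- The negation of n + d ≤ 1 + r c is 2 + r c ≤ n + d, the source of the 2 in `small-rank`.
    ℕ.≤-trans (ℕ.≤-reflexive (ℕ.+-comm (r * ∣ unfixed (κ i) ∣) 2))
      (ℕ.≤-trans (s≤s (s≤s (ℕ.*-monoʳ-≤ r (rank≤ i)))) (ℕ.≰⇒> λ l → ¬large (i , l))))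

-- Rational arithmetic, minima and maxima.

toℚᵘ-/1 : ∀ z → ℚ.toℚᵘ (z ℚ./ 1) ℚᵘ.≃ ℚᵘ.mkℚᵘ z 0
toℚᵘ-/1 z = ℚ.toℚᵘ-fromℚᵘ (ℚᵘ.mkℚᵘ z 0)

/1-mono-≤ : ∀ {x y} → x ℤ.≤ y → x ℚ./ 1 ℚ.≤ y ℚ./ 1
/1-mono-≤ {x} {y} x≤y = ℚ.toℚᵘ-cancel-≤
  (ℚᵘ.≤-respʳ-≃ (ℚᵘ.≃-sym (toℚᵘ-/1 y)) (ℚᵘ.≤-respˡ-≃ (ℚᵘ.≃-sym (toℚᵘ-/1 x))
    (ℚᵘ.*≤* (ℤ.*-monoʳ-≤-nonNeg ℤ.1ℤ x≤y))))

fromℕ-mono-≤ : ∀ {a b} → a ≤ b → fromℕ a ℚ.≤ fromℕ b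
fromℕ-mono-≤ a≤b = /1-mono-≤ (ℤ.+≤+ a≤b)

fromℕ-nonNegative : ∀ a → ℚ.NonNegative (fromℕ a)
fromℕ-nonNegative a = ℚ.nonNegative {fromℕ a} (fromℕ-mono-≤ {0} {a} z≤n)

fromℕ-cancel-≤ : ∀ {a b} → fromℕ a ℚ.≤ fromℕ b → a ≤ b
fromℕ-cancel-≤ {a} {b} a≤b = ℤ.drop‿+≤+ (ℤ.*-cancelʳ-≤-pos (ℤ.+ a) (ℤ.+ b) ℤ.1ℤ
  (ℚᵘ.drop-*≤* (ℚᵘ.≤-respʳ-≃ (toℚᵘ-/1 (ℤ.+ b)) (ℚᵘ.≤-respˡ-≃ (toℚᵘ-/1 (ℤ.+ a)) (ℚ.toℚᵘ-mono-≤ a≤b)))))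

fromℕ-homo-* : ∀ a b → fromℕ (a * b) ≡ fromℕ a ℚ.* fromℕ b
fromℕ-homo-* a b = ℚ.toℚᵘ-injective (begin
  ℚ.toℚᵘ (fromℕ (a * b))                        ≈⟨ toℚᵘ-/1 (ℤ.+ (a * b)) ⟩
  ℚᵘ.mkℚᵘ (ℤ.+ (a * b)) 0                       ≡⟨ cong (λ z → ℚᵘ.mkℚᵘ z 0) (ℤ.pos-* a b) ⟩
  ℚᵘ.mkℚᵘ (ℤ.+ a) 0 ℚᵘ.* ℚᵘ.mkℚᵘ (ℤ.+ b) 0      ≈⟨ ℚᵘ.*-cong (toℚᵘ-/1 (ℤ.+ a)) (toℚᵘ-/1 (ℤ.+ b)) ⟨
  ℚ.toℚᵘ (fromℕ a) ℚᵘ.* ℚ.toℚᵘ (fromℕ b)        ≈⟨ ℚ.toℚᵘ-homo-* (fromℕ a) (fromℕ b) ⟨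
  ℚ.toℚᵘ (fromℕ a ℚ.* fromℕ b)                  ∎)
  where open import Relation.Binary.Reasoning.Setoid ℚᵘ.≃-setoid

fromℕ-homo-+ : ∀ a b → fromℕ (a + b) ≡ fromℕ a ℚ.+ fromℕ b
fromℕ-homo-+ a b = ℚ.toℚᵘ-injective (begin
  ℚ.toℚᵘ (fromℕ (a + b))                        ≈⟨ toℚᵘ-/1 (ℤ.+ (a + b)) ⟩
  ℚᵘ.mkℚᵘ (ℤ.+ a ℤ.+ ℤ.+ b) 0
    ≡⟨ cong₂ (λ x y → ℚᵘ.mkℚᵘ (x ℤ.+ y) 0) (ℤ.*-identityʳ (ℤ.+ a)) (ℤ.*-identityʳ (ℤ.+ b)) ⟨
  ℚᵘ.mkℚᵘ (ℤ.+ a) 0 ℚᵘ.+ ℚᵘ.mkℚᵘ (ℤ.+ b) 0      ≈⟨ ℚᵘ.+-cong (toℚᵘ-/1 (ℤ.+ a)) (toℚᵘ-/1 (ℤ.+ b)) ⟨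
  ℚ.toℚᵘ (fromℕ a) ℚᵘ.+ ℚ.toℚᵘ (fromℕ b)        ≈⟨ ℚ.toℚᵘ-homo-+ (fromℕ a) (fromℕ b) ⟨
  ℚ.toℚᵘ (fromℕ a ℚ.+ fromℕ b)                  ∎)
  where open import Relation.Binary.Reasoning.Setoid ℚᵘ.≃-setoid

ratio-* : ∀ a b → ratio a (suc b) ℚ.* fromℕ (suc b) ≡ fromℕ a
ratio-* a b = ℚ.toℚᵘ-injective (begin
  ℚ.toℚᵘ (ratio a (suc b) ℚ.* fromℕ (suc b))    ≈⟨ ℚ.toℚᵘ-homo-* (ratio a (suc b)) (fromℕ (suc b)) ⟩
  ℚ.toℚᵘ (ratio a (suc b)) ℚᵘ.* ℚ.toℚᵘ (fromℕ (suc b))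
    ≈⟨ ℚᵘ.*-cong (ℚ.toℚᵘ-fromℚᵘ (ℚᵘ.mkℚᵘ (ℤ.+ a) b)) (toℚᵘ-/1 (ℤ.+ suc b)) ⟩
  ℚᵘ.mkℚᵘ (ℤ.+ a) b ℚᵘ.* ℚᵘ.mkℚᵘ (ℤ.+ suc b) 0
    ≈⟨ ℚᵘ.*≡* (trans (ℤ.*-identityʳ _) (cong (λ k → ℤ.+ a ℤ.* ℤ.+ suc k) (sym (ℕ.*-identityʳ b)))) ⟩
  ℚᵘ.mkℚᵘ (ℤ.+ a) 0                             ≈⟨ toℚᵘ-/1 (ℤ.+ a) ⟨
  ℚ.toℚᵘ (fromℕ a)                              ∎)
  where open import Relation.Binary.Reasoning.Setoid ℚᵘ.≃-setoid

floor-≤ : ∀ q → floor q ℚ./ 1 ℚ.≤ q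
floor-≤ q@record{} = ℚ.toℚᵘ-cancel-≤ (ℚᵘ.≤-respˡ-≃ (ℚᵘ.≃-sym (toℚᵘ-/1 (floor q)))
  (ℚᵘ.*≤* (subst (floor q ℤ.* ℚ.↧ q ℤ.≤_) (sym (ℤ.*-identityʳ (ℚ.↥ q)))
    (ℤ.[n/d]*d≤n (ℚ.↥ q) (ℚ.↧ q)))))

minimum-≤ : ∀ {q} qs → q List.∈ qs → minimum qs ℚ.≤ q
minimum-≤ (p ∷ qs) (here refl) = min≤⊤ p qs
minimum-≤ (p ∷ qs) (there q∈)  = All.lookup (min≤xs p qs) q∈

≤-minimum : ∀ {q} qs → 0 < length qs → All (q ℚ.≤_) qs → q ℚ.≤ minimum qs
≤-minimum (_ ∷ _) _ (q≤p ∷ q≤) = v≤min⁺ q≤p q≤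

≤-maximum : ∀ {q} qs → q List.∈ qs → q ℚ.≤ maximum qs
≤-maximum (p ∷ qs) (here refl) = ⊥≤max p qs
≤-maximum (p ∷ qs) (there q∈)  = All.lookup (xs≤max p qs) q∈

∈-subsets : (p : Subset n) → p List.∈ subsets n
∈-subsets []                    = here refl
∈-subsets {suc n} (outside ∷ p) = ∈-++⁺ˡ (∈-map⁺ (outside ∷_) (∈-subsets p))
∈-subsets {suc n} (inside  ∷ p) = ∈-++⁺ʳ (map (outside ∷_) (subsets n)) (∈-map⁺ (inside ∷_) (∈-subsets p))

-- From integer inequalities to the discrepancy.

÷-*-cancel : ∀ p q .{{_ : ℚ.NonZero q}} → (p ÷ q) ℚ.* q ≡ p
÷-*-cancel p q = trans (ℚ.*-assoc p (ℚ.1/ q) q)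
  (trans (cong (p ℚ.*_) (ℚ.*-inverseˡ q)) (ℚ.*-identityʳ p))

-- Each admissible set bounds `ι` by its own ratio, and denominators are cleared. The empty set is
-- not admissible, but for it the inequality is trivial.
ι-expanding : (G : Graph n) (c d : ℕ) → fromℕ d ℚ.* fromℕ c ℚ.≤ ι G ℚ.* fromℕ n →
              ∀ U → 2 * ∣ U ∣ ≤ n → c * d * ∣ U ∣ ≤ n * ∣ N G U ∣
ι-expanding {n} G c d d≤ U U≤ = go (∣ U ∣) refl
  where
  Admissible? : ∀ U → Dec (0 < ∣ U ∣ × 2 * ∣ U ∣ ≤ n)
  Admissible? U = (0 <? ∣ U ∣) ×-dec (2 * ∣ U ∣ ≤? n)
  go : ∀ u → ∣ U ∣ ≡ u → c * d * ∣ U ∣ ≤ n * ∣ N G U ∣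
  go zero    eq = ℕ.≤-trans (ℕ.≤-reflexive (trans (cong (c * d *_) eq) (ℕ.*-zeroʳ (c * d)))) z≤n
  go (suc u) eq = subst (λ x → c * d * x ≤ n * ∣ N G U ∣) (sym eq) (fromℕ-cancel-≤ (begin
    fromℕ (c * d * suc u)
      ≡⟨ cong (λ x → fromℕ (x * suc u)) (ℕ.*-comm c d) ⟩
    fromℕ (d * c * suc u)
      ≡⟨ trans (fromℕ-homo-* (d * c) (suc u)) (cong (ℚ._* fromℕ (suc u)) (fromℕ-homo-* d c)) ⟩
    fromℕ d ℚ.* fromℕ c ℚ.* fromℕ (suc u)
      ≤⟨ ℚ.*-monoʳ-≤-nonNeg (fromℕ (suc u)) {{fromℕ-nonNegative (suc u)}} d≤ ⟩
    ι G ℚ.* fromℕ n ℚ.* fromℕ (suc u)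
      ≤⟨ ℚ.*-monoʳ-≤-nonNeg (fromℕ (suc u)) {{fromℕ-nonNegative (suc u)}}
           (ℚ.*-monoʳ-≤-nonNeg (fromℕ n) {{fromℕ-nonNegative n}} ι≤) ⟩
    ratio a (suc u) ℚ.* fromℕ n ℚ.* fromℕ (suc u)
      ≡⟨ cong (ℚ._* fromℕ (suc u)) (ℚ.*-comm (ratio a (suc u)) (fromℕ n)) ⟩
    fromℕ n ℚ.* ratio a (suc u) ℚ.* fromℕ (suc u)
      ≡⟨ ℚ.*-assoc (fromℕ n) (ratio a (suc u)) (fromℕ (suc u)) ⟩
    fromℕ n ℚ.* (ratio a (suc u) ℚ.* fromℕ (suc u))
      ≡⟨ cong (fromℕ n ℚ.*_) (ratio-* a u) ⟩
    fromℕ n ℚ.* fromℕ a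
      ≡⟨ fromℕ-homo-* n a ⟨
    fromℕ (n * a)                                    ∎))
    where
    open ℚ.≤-Reasoning
    a : ℕ
    a = ∣ N G U ∣
    ι≤ : ι G ℚ.≤ ratio a (suc u)
    ι≤ = subst (λ x → ι G ℚ.≤ ratio a x) eq (minimum-≤ _
      (∈-map⁺ (expansion G) (∈-filter⁺ Admissible? (∈-subsets U) (subst (0 <_) (sym eq) (s≤s z≤n) , U≤))))

-- With `suc n` vertices a spanning tree has n edges, and multiplying the mean by the number of
-- colours restores n.
treeDiscrepancy-≥ : (G : Graph (suc n)) (f : Edge G → Fin (suc r)) (T : EdgeSet G) (i : Fin (suc r)) (d : ℕ) →
                    n + d ≤ suc r * ∣ colourClass G f i ∩ T ∣ →
                    fromℕ d ℚ.≤ treeDiscrepancy G (suc r) f T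
treeDiscrepancy-≥ {n} {r} G f T i d large = begin
  fromℕ d                                          ≡⟨ ℚ.+-identityˡ (fromℕ d) ⟨
  0ℚ ℚ.+ fromℕ d                                   ≡⟨ cong (ℚ._+ fromℕ d) (ℚ.+-inverseˡ (fromℕ n)) ⟨
  ℚ.- fromℕ n ℚ.+ fromℕ n ℚ.+ fromℕ d              ≡⟨ ℚ.+-assoc (ℚ.- fromℕ n) (fromℕ n) (fromℕ d) ⟩
  ℚ.- fromℕ n ℚ.+ (fromℕ n ℚ.+ fromℕ d)            ≡⟨ cong (ℚ.- fromℕ n ℚ.+_) (fromℕ-homo-+ n d) ⟨
  ℚ.- fromℕ n ℚ.+ fromℕ (n + d)                    ≤⟨ ℚ.+-monoʳ-≤ (ℚ.- fromℕ n) (fromℕ-mono-≤ large) ⟩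
  ℚ.- fromℕ n ℚ.+ fromℕ (suc r * c)                ≡⟨ cong (ℚ.- fromℕ n ℚ.+_) (fromℕ-homo-* (suc r) c) ⟩
  ℚ.- fromℕ n ℚ.+ fromℕ (suc r) ℚ.* fromℕ c
    ≤⟨ ℚ.+-monoʳ-≤ (ℚ.- fromℕ n) (ℚ.*-monoˡ-≤-nonNeg (fromℕ (suc r)) {{fromℕ-nonNegative (suc r)}}
         (≤-maximum _ (∈-map⁺ (λ i → fromℕ ∣ colourClass G f i ∩ T ∣) (∈-allFin i)))) ⟩
  ℚ.- fromℕ n ℚ.+ fromℕ (suc r) ℚ.* M              ≡⟨ ℚ.+-comm (ℚ.- fromℕ n) _ ⟩
  fromℕ (suc r) ℚ.* M ℚ.- fromℕ n
    ≡⟨ cong (λ x → fromℕ (suc r) ℚ.* M ℚ.- x) (trans (ℚ.*-comm (fromℕ (suc r)) (ratio n (suc r))) (ratio-* n r)) ⟨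
  fromℕ (suc r) ℚ.* M ℚ.- fromℕ (suc r) ℚ.* ratio n (suc r)
    ≡⟨ cong (fromℕ (suc r) ℚ.* M ℚ.+_) (ℚ.neg-distribʳ-* (fromℕ (suc r)) (ratio n (suc r))) ⟩
  fromℕ (suc r) ℚ.* M ℚ.+ fromℕ (suc r) ℚ.* (ℚ.- ratio n (suc r))
    ≡⟨ ℚ.*-distribˡ-+ (fromℕ (suc r)) M (ℚ.- ratio n (suc r)) ⟨
  treeDiscrepancy G (suc r) f T                    ∎
  where
  open ℚ.≤-Reasoning
  c : ℕ
  c = ∣ colourClass G f i ∩ T ∣
  M : ℚ
  M = maximum (map (λ i → fromℕ ∣ colourClass G f i ∩ T ∣) (allFin (suc r)))

discrepancy-≥ : (G : Graph n) → IsVertexConnected G 2 → 2 ≤ suc r → (d : ℕ) →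
                (∀ U → 2 * ∣ U ∣ ≤ n → 64 * d * ∣ U ∣ ≤ n * ∣ N G U ∣) →
                fromℕ d ℚ.≤ discrepancy G (suc r)
discrepancy-≥ {zero}  G (() , _)
discrepancy-≥ {suc n} {r} G conn 2≤r d expanding =
  ≤-minimum _ nonempty (All.map⁺ {f = worst} (All.universal worst≥ (functions m (suc r))))
  where
  m : ℕ
  m = length (edges G)
  worst : (Edge G → Fin (suc r)) → ℚ
  worst f = maximum (map (treeDiscrepancy G (suc r) f) (spanningTrees G))
  -- Some colouring exists even without edges, so the default value of `minimum` is avoided.
  nonempty : 0 < length (map worst (functions m (suc r)))
  nonempty = subst (0 <_)
    (sym (trans (List.length-map worst (functions m (suc r)))
      (trans (List.length-map (Fin.finToFun {suc r} {m}) (allFin (suc r ℕ.^ m))) (List.length-tabulate {n = suc r ℕ.^ m} id))))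
    (ℕ.m^n>0 (suc r) m)
  worst≥ : ∀ f → fromℕ d ℚ.≤ worst f
  worst≥ f = let T , i , tree , large = unbalanced-tree G conn 2≤r d expanding f in
    ℚ.≤-trans (treeDiscrepancy-≥ G f T i d (ℕ.s≤s⁻¹ large))
      (≤-maximum _ (∈-map⁺ (treeDiscrepancy G (suc r) f) (∈-filter⁺ (isSpanningTree? G) (∈-subsets T) tree)))

-- The floor is generalised to any integer below the quotient so that its sign can be examined: a
-- nonnegative one serves as `d`, a negative one follows from `d = 0`, where expansion is trivial.
discrepancy-≥-floor : (G : Graph n) → IsVertexConnected G 2 → 2 ≤ suc r →
                      .{{_ : ℚ.NonZero (fromℕ 64)}} →
                      floor (ι G ℚ.* fromℕ n ÷ fromℕ 64) ℚ./ 1 ℚ.≤ discrepancy G (suc r)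
discrepancy-≥-floor {n} {r} G conn 2≤r = go (floor q) (floor-≤ q)
  where
  q : ℚ
  q = ι G ℚ.* fromℕ n ÷ fromℕ 64
  go : ∀ z → z ℚ./ 1 ℚ.≤ q → z ℚ./ 1 ℚ.≤ discrepancy G (suc r)
  go (ℤ.+ d) d≤q = discrepancy-≥ G conn 2≤r d (ι-expanding G 64 d
    (subst (fromℕ d ℚ.* fromℕ 64 ℚ.≤_) (÷-*-cancel (ι G ℚ.* fromℕ n) (fromℕ 64))
      (ℚ.*-monoʳ-≤-nonNeg (fromℕ 64) {{fromℕ-nonNegative 64}} d≤q)))
  go ℤ.-[1+ k ] _ = ℚ.≤-trans (/1-mono-≤ {ℤ.-[1+ k ]} {ℤ.+ 0} ℤ.-≤+) (discrepancy-≥ G conn 2≤r 0 λ _ _ → z≤n)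

corollary1p3 : (r : ℕ) .{{_ : NonZero r}} → 2 ≤ r →
    Σ[ C ∈ ℚ ] Σ[ C>0 ∈ C ℚ.> 0ℚ ]
    ((n : ℕ) (G : Graph n) →
    IsVertexConnected G 3
    ⊎ (IsVertexConnected G 2 × (ι G ℚ.* ι G) ℚ.* fromℕ n ℚ.≥ C ℚ.* C) →
    discrepancy G r ℚ.≥ floor (_÷_ (ι G ℚ.* fromℕ n) C {{>-nonZero C>0}}) ℚ./ 1)
-- The value 64 is the factor in `expanding`, from which `small-side` obtains n / 32.
corollary1p3 (suc r) 2≤r = fromℕ 64 , ℚ.positive⁻¹ (fromℕ 64) ,
  λ n G conn → discrepancy-≥-floor G ([ weaken G , proj₁ ]′ conn) 2≤r
  where
  weaken : (G : Graph n) → IsVertexConnected G 3 → IsVertexConnected G 2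
  weaken G (3<n , conn) = ℕ.<⇒≤ 3<n , λ S S<2 → conn S (ℕ.m≤n⇒m≤1+n S<2)
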